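{- Let $p$ be a prime, $q=p^f$ with $f\ge1$, let $k\mid q-1$, and let $A_k=\{x^k:x\in\mathbb{F}_q^\times\}$ be a proper subgroup of $\mathbb{F}_q^\times$ with $\mathbb{F}_p(A_k)=\mathbb{F}_q$ and order $t=|A_k|=(q-1)/k\ge5$. If $A_k=S+T$ for subsets $S,T\subseteq\mathbb{F}_q$ with $|S|,|T|\ge2$, then $$3\le |S|\le \frac t2\quad\text{and}\quad 3\le|T|\le\frac t2,$$ and if $k\ge3$ then the upper bounds are strict: $|S|<t/2$ and $|T|<t/2$.
   Context: $S+T=\{s+u:s\in S,\ u\in T\}$ is the sumset in the additive group of $\mathbb{F}_q$. $\mathbb{F}_p(A_k)$ denotes the smallest subfield of $\mathbb{F}_q$ containing $A_k$. $A_k$ is the unique subgroup of index $k$ in $\mathbb{F}_q^\times$. -}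

module Defs where

open import Algebra.Bundles using (CommutativeRing)
import Algebra.Properties.Semiring.Exp as Exp
open import Data.Bool.Base using (true)
open import Data.Fin.Base using (Fin)
import Data.Fin.Properties as Fin
import Data.Fin.Subset as Subset
open import Data.Fin.Subset using (Subset)
import Data.Fin.Subset.Properties as Subset
open import Data.Nat.Base using (ℕ)
open import Data.Product.Base using (∃; ∃₂; _×_; _,_)
open import Data.Vec.Base using (tabulate)
open import Data.Vec.Properties using (lookup⇒[]=; []=⇒lookup; lookup∘tabulate)
open import Function.Base using (_∘_)
open import Function.Bundles using (Inverse; _⇔_; mk⇔)
open import Function.Properties.Inverse using (Inverse⇒Injection)
open import Level using (suc; _⊔_)
open import Relation.Binary.Core using (Rel)
open import Relation.Binary.Definitions using (_Respects_) renaming (Decidable to Decidable₂)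
import Relation.Binary.PropositionalEquality as ≡
open ≡ using (_≡_)
open import Relation.Nullary.Decidable
  using (Dec; does; yes; no; map′; _×-dec_; ¬?; via-injection; dec-true)
open import Relation.Nullary.Negation.Core using (¬_)
open import Relation.Unary using (Pred; Decidable)

record FiniteField c ℓ (q : ℕ) : Set (suc (c ⊔ ℓ)) where
  field
    commutativeRing : CommutativeRing c ℓ

  open CommutativeRing commutativeRing public

  field
    1≉0         : ¬ (1# ≈ 0#)
    inverses    : ∀ x → ¬ (x ≈ 0#) → ∃ λ y → x * y ≈ 1#
    enumeration : Inverse setoid (≡.setoid (Fin q))

  open Exp semiring public using (_^_; ^-congˡ)

  index : Carrier → Fin q
  index = Inverse.to enumeration

  element : Fin q → Carrier
  element = Inverse.from enumeration

  index-element : ∀ i → index (element i) ≡ i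
  index-element i = Inverse.inverseˡ enumeration refl

  element-index : ∀ x → element (index x) ≈ x
  element-index x = Inverse.inverseʳ enumeration ≡.refl

  _≈?_ : Decidable₂ _≈_
  _≈?_ = via-injection (Inverse⇒Injection enumeration) Fin._≟_

  any? : ∀ {p} {P : Pred Carrier p} → P Respects _≈_ → Decidable P → Dec (∃ P)
  any? {P = P} resp P? =
    map′ (λ (i , Pi) → element i , Pi)
         (λ (x , Px) → index x , resp (sym (element-index x)) Px)
         (Fin.any? (P? ∘ element))

-- Subsets of the field are represented by subsets of Fin q, along the
-- enumeration, so that ∣_∣ from Data.Fin.Subset is their cardinality.

module FieldSubsets {c ℓ q} (F : FiniteField c ℓ q) where
  open FiniteField F

  infix 4 _∈_

  _∈_ : Carrier → Subset q → Set
  x ∈ S = index x Subset.∈ S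

  _∈?_ : ∀ x S → Dec (x ∈ S)
  x ∈? S = index x Subset.∈? S

  ∈-resp : ∀ S → (_∈ S) Respects _≈_
  ∈-resp S x≈y = ≡.subst (Subset._∈ S) (Inverse.to-cong enumeration x≈y)

  comprehension : ∀ {p} {P : Pred Carrier p} → Decidable P → Subset q
  comprehension P? = tabulate (does ∘ P? ∘ element)

  ∈-comprehension : ∀ {p} {P : Pred Carrier p} (P? : Decidable P) →
                    P Respects _≈_ → ∀ x → x ∈ comprehension P? ⇔ P x
  ∈-comprehension {P = P} P? resp x = mk⇔ to from
    where
    lookup≡ = lookup∘tabulate (does ∘ P? ∘ element) (index x)

    holds : (d : Dec (P (element (index x)))) → does d ≡ true → P (element (index x))
    holds (yes p) _ = p
    holds (no _) ()

    to : x ∈ comprehension P? → P x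
    to x∈ = resp (element-index x)
      (holds (P? (element (index x))) (≡.trans (≡.sym lookup≡) ([]=⇒lookup x∈)))

    from : P x → x ∈ comprehension P?
    from Px = lookup⇒[]= (index x) _ (≡.trans lookup≡
      (dec-true (P? _) (resp (sym (element-index x)) Px)))

  IsUnit : Pred Carrier ℓ
  IsUnit x = ¬ (x ≈ 0#)

  IsUnit-resp : IsUnit Respects _≈_
  IsUnit-resp x≈y x≉0 y≈0 = x≉0 (trans x≈y y≈0)

  isUnit? : Decidable IsUnit
  isUnit? x = ¬? (x ≈? 0#)

  units : Subset q
  units = comprehension isUnit?

  IsPower : ℕ → Pred Carrier (c ⊔ ℓ)
  IsPower k a = ∃ λ x → IsUnit x × a ≈ x ^ k

  isPower? : ∀ k → Decidable (IsPower k)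
  isPower? k a = any?
    (λ x≈y (x≉0 , a≈xᵏ) → IsUnit-resp x≈y x≉0 , trans a≈xᵏ (^-congˡ k x≈y))
    (λ x → isUnit? x ×-dec (a ≈? (x ^ k)))

  powers : ℕ → Subset q
  powers k = comprehension (isPower? k)

  IsSum : (S T : Subset q) → Pred Carrier (c ⊔ ℓ)
  IsSum S T a = ∃₂ λ s u → s ∈ S × u ∈ T × a ≈ s + u

  isSum? : ∀ S T → Decidable (IsSum S T)
  isSum? S T a = any?
    (λ s≈s′ (u , s∈S , u∈T , a≈s+u) →
      u , ∈-resp S s≈s′ s∈S , u∈T , trans a≈s+u (+-congʳ s≈s′))
    (λ s → any?
      (λ u≈u′ (s∈S , u∈T , a≈s+u) →
        s∈S , ∈-resp T u≈u′ u∈T , trans a≈s+u (+-congˡ u≈u′))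
      (λ u → (s ∈? S) ×-dec ((u ∈? T) ×-dec (a ≈? (s + u)))))

  infixl 6 _⊕_

  _⊕_ : (S T : Subset q) → Subset q
  S ⊕ T = comprehension (isSum? S T)

  ∈-units : ∀ x → x ∈ units ⇔ IsUnit x
  ∈-units = ∈-comprehension isUnit? IsUnit-resp

  ∈-powers : ∀ k a → a ∈ powers k ⇔ IsPower k a
  ∈-powers k = ∈-comprehension (isPower? k)
    (λ a≈b (x , x≉0 , a≈xᵏ) → x , x≉0 , trans (sym a≈b) a≈xᵏ)

  ∈-⊕ : ∀ S T a → a ∈ S ⊕ T ⇔ IsSum S T a
  ∈-⊕ S T = ∈-comprehension (isSum? S T)
    (λ a≈b (s , u , s∈S , u∈T , a≈s+u) → s , u , s∈S , u∈T , trans (sym a≈b) a≈s+u)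

  record IsSubfield {p} (K : Pred Carrier p) : Set (c ⊔ ℓ ⊔ p) where
    field
      resp       : K Respects _≈_
      0-closed   : K 0#
      1-closed   : K 1#
      +-closed   : ∀ {x y} → K x → K y → K (x + y)
      neg-closed : ∀ {x} → K x → K (- x)
      *-closed   : ∀ {x y} → K x → K y → K (x * y)
      inv-closed : ∀ {x y} → x * y ≈ 1# → K x → K y

  -- The smallest subfield containing A.  Every subfield contains the prime
  -- field 𝔽ₚ, so 𝔽ₚ needs no generators of its own.

  data 𝔽ₚ⟨_⟩ (A : Subset q) : Pred Carrier (c ⊔ ℓ) where
    gen  : ∀ {x} → x ∈ A → 𝔽ₚ⟨ A ⟩ x
    resp : ∀ {x y} → x ≈ y → 𝔽ₚ⟨ A ⟩ x → 𝔽ₚ⟨ A ⟩ y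
    zero′ : 𝔽ₚ⟨ A ⟩ 0#
    one  : 𝔽ₚ⟨ A ⟩ 1#
    add  : ∀ {x y} → 𝔽ₚ⟨ A ⟩ x → 𝔽ₚ⟨ A ⟩ y → 𝔽ₚ⟨ A ⟩ (x + y)
    neg  : ∀ {x} → 𝔽ₚ⟨ A ⟩ x → 𝔽ₚ⟨ A ⟩ (- x)
    mul  : ∀ {x y} → 𝔽ₚ⟨ A ⟩ x → 𝔽ₚ⟨ A ⟩ y → 𝔽ₚ⟨ A ⟩ (x * y)
    inv  : ∀ {x y} → x * y ≈ 1# → 𝔽ₚ⟨ A ⟩ x → 𝔽ₚ⟨ A ⟩ y

  𝔽ₚ⟨⟩-isSubfield : ∀ A → IsSubfield 𝔽ₚ⟨ A ⟩
  𝔽ₚ⟨⟩-isSubfield A = record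
    { resp = resp ; 0-closed = zero′ ; 1-closed = one ; +-closed = add
    ; neg-closed = neg ; *-closed = mul ; inv-closed = inv }

  𝔽ₚ⟨⟩-least : ∀ {p} {A} {K : Pred Carrier p} → IsSubfield K →
               (∀ {x} → x ∈ A → K x) → ∀ {x} → 𝔽ₚ⟨ A ⟩ x → K x
  𝔽ₚ⟨⟩-least {A = A} {K} isSubfield A⊆K = go
    where
    module K = IsSubfield isSubfield

    go : ∀ {x} → 𝔽ₚ⟨ A ⟩ x → K x
    go (gen x∈A)   = A⊆K x∈A
    go (resp eq x) = K.resp eq (go x)
    go zero′       = K.0-closed
    go one         = K.1-closed
    go (add x y)   = K.+-closed (go x) (go y)
    go (neg x)     = K.neg-closed (go x)
    go (mul x y)   = K.*-closed (go x) (go y)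
    go (inv eq x)  = K.inv-closed eq (go x)

{-# OPTIONS --safe #-}

-- Let A be the subgroup of order t, n = t + 1, and let u₁ ≠ u₂ lie in T.  Every
-- s in S satisfies (s + u₁)ᵗ = (s + u₂)ᵗ = 1, hence is a double root of
-- (x + u₁)ⁿ - (x + u₂)ⁿ - (u₁ - u₂), of degree t if p ∤ n; so 2 |S| ≤ t.  If p ∣ n,
-- this polynomial is one in x ^ P for a power P of p, and has fewer roots still.
-- Equality 2 |S| = t is impossible: a third element of T gives a combination
-- Σ c (x + u)ⁿ of degree t - 1 with the same double roots, while for |T| = 2
-- comparing the polynomial, a square up to a constant, with
-- xᵗ - 1 = Π (x - u₁ - s) Π (x - u₂ - s) yields two contradictory relations among
-- the first binomial coefficients of n.  Finally |S| = 2 would force t ≤ 2 |T|.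

module Submission where

open import Algebra.Bundles using (CommutativeRing)
import Algebra.Properties.CommutativeMonoid.Sum as Sum
import Algebra.Properties.CommutativeSemiring.Exp as Exp
import Algebra.Properties.Monoid.Mult.TCOptimised as MonoidMultiples
import Algebra.Properties.Ring as RingProperties
import Algebra.Properties.Semiring.Mult.TCOptimised as Multiples
import Algebra.Solver.Ring as RingSolver
open import Algebra.Solver.Ring.AlmostCommutativeRing using (fromCommutativeRing; _-Raw-AlmostCommutative⟶_)
open import Data.Empty using (⊥; ⊥-elim)
open import Data.Fin.Base using (Fin; zero; suc)
open import Data.Fin.Permutation using (permutation)
open import Data.Fin.Subset using (Subset; ∣_∣; _⊂_; inside; outside)
import Data.Fin.Subset as Subset
open import Data.Integer.Base as ℤ using (ℤ; +_; -[1+_]; _⊖_; _◃_)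
import Data.Integer.Properties as ℤ
open import Data.List.Base using (List; []; _∷_; length; map)
open import Data.List.Properties using (length-map; length-++)
open import Data.List.Relation.Unary.All as All using (All; []; _∷_)
import Data.List.Relation.Unary.All.Properties as All
open import Data.List.Relation.Unary.AllPairs using ([]; _∷_)
open import Data.List.Relation.Unary.Any as Any using (Any; here; there)
import Data.List.Relation.Unary.Any.Properties as Any
open import Data.List.Relation.Unary.Unique.Propositional using (Unique)
import Data.List.Relation.Unary.Unique.Propositional.Properties as Unique
import Data.List.Relation.Unary.Unique.Setoid as UniqueSetoid
import Data.List.Relation.Unary.Unique.Setoid.Properties as DistinctProperties
import Data.Maybe.Base as Maybe
open import Data.Nat.Base as ℕ using (ℕ; zero; suc)
open import Data.Nat.Coprimality using (Coprime; coprime-Bézout)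
open import Data.Nat.Divisibility using (_∣_; _∤_; _∣?_; _∣0; divides; ∣⇒≤)
open import Data.Nat.GCD using (module Bézout)
open import Data.Nat.Induction using (<-wellFounded)
open import Data.Nat.Primality using (Prime; prime⇒irreducible; prime⇒nonTrivial)
import Data.Nat.Properties as ℕ
open import Data.Product.Base using (∃; ∃₂; _×_; _,_; proj₁; proj₂)
import Data.Sign.Base as Sign
open import Data.Sum.Base using (inj₁; inj₂)
open import Data.Vec.Base using ([]; _∷_; here; there)
open import Defs using (FiniteField; module FieldSubsets)
open import Function.Base using (id)
open import Function.Bundles using (module Inverse; module Equivalence)
open import Induction.WellFounded using (Acc; acc)
open import Level using (_⊔_)
open import Relation.Binary.Consequences using (dec⇒weaklyDec)
import Relation.Binary.PropositionalEquality as ≡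
open ≡ using (_≡_; _≢_)
import Relation.Binary.Reasoning.Setoid as SetoidReasoning
open import Relation.Nullary.Decidable using (yes; no)
open import Relation.Nullary.Negation.Core using (¬_)

-- The exponent n = t + 1 is chosen because aⁿ = a on A: a weighted sum of powers (s + u)ⁿ becomes
-- linear in s, and its derivative is n times a weighted sum of t-th powers that all equal 1. The
-- obstacle is that polynomials over a finite field are seen here only through their functions, so
-- coefficients can be compared only when there are more points than the degree. For |T| = 2 the
-- unknown polynomial of S is eliminated, which leaves an identity in z = (u₁ - u₂) / x of degree at
-- most 2 n = 2 t + 2, valid for z ≠ 0. Its lowest terms cancel and z⁴ divides out, so that degree 2
-- t - 2 remains; since A is proper there is a second coset gA, and A and gA together give 2 t
-- nonzero points, which is enough. The condition t ≥ 5 keeps the terms with zᵗ or zⁿ away from z⁴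
-- and z⁶, whose coefficients are the two contradictory relations.

module IntegerCoefficients {c ℓ} (R : CommutativeRing c ℓ) where
  open CommutativeRing R hiding (zero)
  open RingProperties ring using (-0#≈0#; -‿distribˡ-*; -‿distribʳ-*; -‿involutive; -‿+-comm)
  open Multiples semiring using (×-homo-+; ×1-homo-*; 1+×) public
  open Multiples semiring using () renaming (_×_ to _×ℕ_)
  open SetoidReasoning setoid

  ι : ℕ → Carrier
  ι n = n ×ℕ 1#

  -- The canonical homomorphism from the integers. Integer coefficients have decidable equality, so
  -- the ring solver can compute with literals such as 10 although the characteristic is unknown.
  fromℤ : ℤ → Carrier
  fromℤ (+ n)    = ι n
  fromℤ -[1+ n ] = - ι (suc n)

  fromℤ-⊖ : ∀ m n → fromℤ (m ⊖ n) ≈ ι m - ι n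
  fromℤ-⊖ m zero = sym (trans (+-congˡ -0#≈0#) (+-identityʳ _))
  fromℤ-⊖ zero (suc n) = sym (+-identityˡ _)
  fromℤ-⊖ (suc m) (suc n) = begin
    fromℤ (suc m ⊖ suc n)              ≡⟨ ≡.cong fromℤ (ℤ.[1+m]⊖[1+n]≡m⊖n m n) ⟩
    fromℤ (m ⊖ n)                      ≈⟨ fromℤ-⊖ m n ⟩
    ι m - ι n                          ≈⟨ +-congʳ (+-identityˡ _) ⟨
    0# + ι m - ι n                     ≈⟨ +-congʳ (+-congʳ (-‿inverseʳ 1#)) ⟨
    1# - 1# + ι m - ι n                ≈⟨ +-congʳ (+-assoc _ _ _) ⟩
    1# + (- 1# + ι m) - ι n            ≈⟨ +-congʳ (+-congˡ (+-comm _ _)) ⟩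
    1# + (ι m - 1#) - ι n              ≈⟨ +-congʳ (+-assoc _ _ _) ⟨
    1# + ι m - 1# - ι n                ≈⟨ +-assoc _ _ _ ⟩
    1# + ι m + (- 1# - ι n)            ≈⟨ +-congˡ (-‿+-comm 1# (ι n)) ⟩
    1# + ι m - (1# + ι n)              ≈⟨ +-cong (1+× m 1#) (-‿cong (1+× n 1#)) ⟨
    ι (suc m) - ι (suc n)              ∎

  fromℤ-+ : ∀ i j → fromℤ (i ℤ.+ j) ≈ fromℤ i + fromℤ j
  fromℤ-+ (+ m)    (+ n)    = ×-homo-+ 1# m n
  fromℤ-+ (+ m)    -[1+ n ] = fromℤ-⊖ m (suc n)
  fromℤ-+ -[1+ m ] (+ n)    = trans (fromℤ-⊖ n (suc m)) (+-comm _ _)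
  fromℤ-+ -[1+ m ] -[1+ n ] = begin
    - ι (suc (suc (m ℕ.+ n)))   ≡⟨ ≡.cong (λ k → - ι (suc k)) (≡.sym (ℕ.+-suc m n)) ⟩
    - ι (suc m ℕ.+ suc n)       ≈⟨ -‿cong (×-homo-+ 1# (suc m) (suc n)) ⟩
    - (ι (suc m) + ι (suc n))   ≈⟨ -‿+-comm _ _ ⟨
    - ι (suc m) - ι (suc n)     ∎

  fromℤ-neg : ∀ i → fromℤ (ℤ.- i) ≈ - fromℤ i
  fromℤ-neg (+ zero)  = sym -0#≈0#
  fromℤ-neg (+ suc n) = refl
  fromℤ-neg -[1+ n ]  = sym (-‿involutive _)

  fromℤ-+◃ : ∀ n → fromℤ (Sign.+ ◃ n) ≈ ι n
  fromℤ-+◃ zero    = refl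
  fromℤ-+◃ (suc n) = refl

  fromℤ--◃ : ∀ n → fromℤ (Sign.- ◃ n) ≈ - ι n
  fromℤ--◃ zero    = sym -0#≈0#
  fromℤ--◃ (suc n) = refl

  fromℤ-* : ∀ i j → fromℤ (i ℤ.* j) ≈ fromℤ i * fromℤ j
  fromℤ-* (+ m) (+ n) = trans (fromℤ-+◃ (m ℕ.* n)) (×1-homo-* m n)
  fromℤ-* (+ m) -[1+ n ] = trans (fromℤ--◃ (m ℕ.* suc n))
    (trans (-‿cong (×1-homo-* m (suc n))) (-‿distribʳ-* _ _))
  fromℤ-* -[1+ m ] (+ n) = trans (fromℤ--◃ (suc m ℕ.* n))
    (trans (-‿cong (×1-homo-* (suc m) n)) (-‿distribˡ-* _ _))
  fromℤ-* -[1+ m ] -[1+ n ] = begin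
    ι (suc m ℕ.* suc n)            ≈⟨ ×1-homo-* (suc m) (suc n) ⟩
    ι (suc m) * ι (suc n)          ≈⟨ -‿involutive _ ⟨
    - (- (ι (suc m) * ι (suc n)))  ≈⟨ -‿cong (-‿distribˡ-* _ _) ⟩
    - ((- ι (suc m)) * ι (suc n))  ≈⟨ -‿distribʳ-* _ _ ⟩
    (- ι (suc m)) * (- ι (suc n))  ∎

  morphism : CommutativeRing.rawRing ℤ.+-*-commutativeRing -Raw-AlmostCommutative⟶ fromCommutativeRing R
  morphism = record
    { ⟦_⟧    = fromℤ
    ; +-homo = fromℤ-+
    ; *-homo = fromℤ-*
    ; -‿homo = fromℤ-neg
    ; 0-homo = refl
    ; 1-homo = refl
    }

  open RingSolver (CommutativeRing.rawRing ℤ.+-*-commutativeRing) (fromCommutativeRing R) morphism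
    (λ i j → Maybe.map (λ i≡j → reflexive (≡.cong fromℤ i≡j)) (dec⇒weaklyDec ℤ._≟_ i j))
    using (solve; con; _:+_; _:*_; _:-_; :-_; _:=_) public

-- Polynomial functions: degree, formal derivative, simple and double roots.

module PolynomialFunctions {c ℓ} (R : CommutativeRing c ℓ) where
  open CommutativeRing R hiding (zero)
  open IntegerCoefficients R using (ι; 1+×; solve; con; _:+_; _:*_; _:-_; :-_; _:=_)
  open RingProperties ring using ()
    renaming (x∙y⁻¹≈ε⇒x≈y to x-y≈0⇒x≈y; x≈y⇒x∙y⁻¹≈ε to x≈y⇒x-y≈0)
  open Exp commutativeSemiring using (_^_)
  open UniqueSetoid setoid using () renaming (Unique to Distinct)
  open SetoidReasoning setoid

  -- Polynomial d a f f′: f is the function of a polynomial of degree at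
  -- most d whose coefficient of degree d is a, and f′ that of its formal
  -- derivative.

  data Polynomial : ℕ → Carrier → (f f′ : Carrier → Carrier) → Set (c ⊔ ℓ) where
    constant : ∀ {a f f′} → (∀ x → f x ≈ a) → (∀ x → f′ x ≈ 0#) → Polynomial 0 a f f′
    horner   : ∀ {d a f f′ g g′} b → Polynomial d a g g′ →
               (∀ x → f x ≈ b + x * g x) → (∀ x → f′ x ≈ g x + x * g′ x) →
               Polynomial (suc d) a f f′

  Degree≤ : ℕ → (Carrier → Carrier) → Set (c ⊔ ℓ)
  Degree≤ d f = ∃₂ λ a f′ → Polynomial d a f f′

  private
    variable
      d e : ℕ
      a b : Carrier
      f f′ g g′ : Carrier → Carrier

  polynomial-resp : a ≈ b → (∀ x → g x ≈ f x) → (∀ x → g′ x ≈ f′ x) →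
                    Polynomial d a f f′ → Polynomial d b g g′
  polynomial-resp a≈b f≈g f′≈g′ (constant p p′) =
    constant (λ x → trans (f≈g x) (trans (p x) a≈b)) (λ x → trans (f′≈g′ x) (p′ x))
  polynomial-resp a≈b f≈g f′≈g′ (horner k h p p′) =
    horner k (polynomial-resp a≈b (λ _ → refl) (λ _ → refl) h)
      (λ x → trans (f≈g x) (p x)) (λ x → trans (f′≈g′ x) (p′ x))

  constant′ : ∀ a → Polynomial 0 a (λ _ → a) (λ _ → 0#)
  constant′ a = constant (λ _ → refl) (λ _ → refl)

  times-x : Polynomial d a f f′ → Polynomial (suc d) a (λ x → x * f x) (λ x → f x + x * f′ x)
  times-x h = horner 0# h (λ _ → sym (+-identityˡ _)) (λ _ → refl)

  raise : Polynomial d a f f′ → Polynomial (suc d) 0# f f′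
  raise (constant {a} p p′) = horner a (constant′ 0#)
    (λ x → trans (p x) (solve 2 (λ a x → a := a :+ x :* con (+ 0)) refl a x))
    (λ x → trans (p′ x) (solve 1 (λ x → con (+ 0) := con (+ 0) :+ x :* con (+ 0)) refl x))
  raise (horner b h p p′) = horner b (raise h) p p′

  raise-by : ∀ k → Polynomial d a f f′ → Polynomial (suc k ℕ.+ d) 0# f f′
  raise-by zero    h = raise h
  raise-by (suc k) h = raise (raise-by k h)

  add : Polynomial d a f f′ → Polynomial d b g g′ →
        Polynomial d (a + b) (λ x → f x + g x) (λ x → f′ x + g′ x)
  add (constant p p′) (constant q q′) =
    constant (λ x → +-cong (p x) (q x)) (λ x → trans (+-cong (p′ x) (q′ x)) (+-identityˡ 0#))
  add (horner b h p p′) (horner c k q q′) = horner (b + c) (add h k)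
    (λ x → trans (+-cong (p x) (q x))
      (solve 5 (λ b c x h k → b :+ x :* h :+ (c :+ x :* k) := b :+ c :+ x :* (h :+ k)) refl b c x _ _))
    (λ x → trans (+-cong (p′ x) (q′ x))
      (solve 5 (λ h k x h′ k′ → h :+ x :* h′ :+ (k :+ x :* k′) := h :+ k :+ x :* (h′ :+ k′)) refl _ _ x _ _))

  add-constant : ∀ k → Polynomial (suc d) a f f′ → Polynomial (suc d) a (λ x → f x + k) f′
  add-constant k (horner b h p p′) = horner (b + k) h
    (λ x → trans (+-congʳ (p x)) (solve 3 (λ b k y → b :+ y :+ k := b :+ k :+ y) refl b k _)) p′

  scale : ∀ k → Polynomial d a f f′ → Polynomial d (k * a) (λ x → k * f x) (λ x → k * f′ x)
  scale k (constant p p′) = constant (λ x → *-congˡ (p x)) (λ x → trans (*-congˡ (p′ x)) (zeroʳ k))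
  scale k (horner b h p p′) = horner (k * b) (scale k h)
    (λ x → trans (*-congˡ (p x)) (solve 4 (λ k b x h → k :* (b :+ x :* h) := k :* b :+ x :* (k :* h)) refl k b x _))
    (λ x → trans (*-congˡ (p′ x)) (solve 4 (λ k x h h′ → k :* (h :+ x :* h′) :=
        k :* h :+ x :* (k :* h′)) refl k x _ _))

  mul : Polynomial d a f f′ → Polynomial e b g g′ →
        Polynomial (d ℕ.+ e) (a * b) (λ x → f x * g x) (λ x → f′ x * g x + f x * g′ x)
  mul {a = a} {g = g} {g′ = g′} (constant p p′) k = polynomial-resp refl
    (λ x → *-congʳ (p x))
    (λ x → trans (+-cong (*-congʳ (p′ x)) (*-congʳ (p x)))
                 (solve 3 (λ a g g′ → con (+ 0) :* g :+ a :* g′ := a :* g′) refl a (g x) (g′ x)))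
    (scale a k)
  mul {g = g} {g′ = g′} (horner {d = d} b h p p′) k = polynomial-resp (+-identityˡ _)
    (λ x → trans (*-congʳ (p x))
      (solve 4 (λ b x h k → (b :+ x :* h) :* k := b :* k :+ x :* (h :* k)) refl b x _ (g x)))
    (λ x → trans (+-cong (*-congʳ (p′ x)) (*-congʳ (p x)))
      (solve 6 (λ b x h h′ k k′ → (h :+ x :* h′) :* k :+ (b :+ x :* h) :* k′ :=
                                  b :* k′ :+ (h :* k :+ x :* (h′ :* k :+ h :* k′)))
        refl b x _ _ (g x) (g′ x)))
    -- `scale b k` has degree `e` and must reach `suc d + e`; `raise-by d` raises by `suc d`.
    (add (raise-by d (scale b k)) (times-x (mul h k)))

  affine : ∀ a b → Polynomial 1 a (λ x → a * x + b) (λ _ → a)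
  affine a b = horner b (constant′ a)
    (λ x → solve 3 (λ a b x → a :* x :+ b := b :+ x :* a) refl a b x)
    (λ x → solve 2 (λ a x → a := a :+ x :* con (+ 0)) refl a x)

  -- Synthetic division. The second identity is the formal derivative of the first; at `x = s` it
  -- becomes `f′ s ≈ g s`, so a double root of `f` is a root of the quotient.
  divide : ∀ s → Polynomial (suc d) a f f′ → ∃₂ λ g g′ →
           Polynomial d a g g′ × (∀ x → f x ≈ f s + (x - s) * g x) ×
           (∀ x → f′ x ≈ g x + (x - s) * g′ x)
  divide s (horner b (constant {a} q q′) p p′) = (λ _ → a) , (λ _ → 0#) , constant′ a ,
    (λ x → begin
      _                        ≈⟨ trans (p x) (+-congˡ (*-congˡ (q x))) ⟩
      b + x * a                ≈⟨ solve 4 (λ a b s x → b :+ x :* a := b :+ s :* a :+ (x :- s) :* a) refl a b s x ⟩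
      b + s * a + (x - s) * a  ≈⟨ +-congʳ (trans (p s) (+-congˡ (*-congˡ (q s)))) ⟨
      _                        ∎) ,
    λ x → trans (p′ x) (trans (+-cong (q x) (*-congˡ (q′ x)))
      (solve 3 (λ a s x → a :+ x :* con (+ 0) := a :+ (x :- s) :* con (+ 0)) refl a s x))
  divide s (horner {g = h} b hp@(horner _ _ _ _) p p′) with divide s hp
  ... | g , g′ , gp , q , q′ =
    (λ x → h s + x * g x) , _ , horner (h s) gp (λ _ → refl) (λ _ → refl) ,
    (λ x → begin
      _                                           ≈⟨ trans (p x) (+-congˡ (*-congˡ (q x))) ⟩
      b + x * (h s + (x - s) * g x)
        ≈⟨ solve 5 (λ b x s h g → b :+ x :* (h :+ (x :- s) :* g) :=
            b :+ s :* h :+ (x :- s) :* (h :+ x :* g)) refl b x s (h s) (g x) ⟩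
      b + s * h s + (x - s) * (h s + x * g x)     ≈⟨ +-congʳ (p s) ⟨
      _                                           ∎) ,
    λ x → trans (p′ x) (trans (+-cong (q x) (*-congˡ (q′ x)))
      (solve 5 (λ x s h g g′ → (h :+ (x :- s) :* g) :+ x :* (g :+ (x :- s) :* g′) :=
                               (h :+ x :* g) :+ (x :- s) :* (g :+ x :* g′))
        refl x s (h s) (g x) (g′ x)))

  factor : ∀ s → Polynomial (suc d) a f f′ → f s ≈ 0# → ∃₂ λ g g′ →
           Polynomial d a g g′ × (∀ x → f x ≈ (x - s) * g x) ×
           (∀ x → f′ x ≈ g x + (x - s) * g′ x)
  factor s fp fs≈0 with divide s fp
  ... | g , g′ , gp , q , q′ =
    g , g′ , gp , (λ x → trans (q x) (trans (+-congʳ fs≈0) (+-identityˡ _))) , q′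

  rootProduct : List Carrier → Carrier → Carrier
  rootProduct []       x = 1#
  rootProduct (s ∷ ss) x = (x - s) * rootProduct ss x

  rootProduct-cong : ∀ ss {x y} → x ≈ y → rootProduct ss x ≈ rootProduct ss y
  rootProduct-cong []       x≈y = refl
  rootProduct-cong (s ∷ ss) x≈y = *-cong (+-congʳ x≈y) (rootProduct-cong ss x≈y)

  rootProduct-root : ∀ {ss x} → Any (x ≈_) ss → rootProduct ss x ≈ 0#
  rootProduct-root (here x≈s) = trans (*-congʳ (x≈y⇒x-y≈0 x≈s)) (zeroˡ _)
  rootProduct-root (there i)  = trans (*-congˡ (rootProduct-root i)) (zeroʳ _)

  -- The affine argument serves two purposes: dilations `a * x` of the subgroup and translates
  -- `x - u` of a summand.
  rootProduct-affine : ∀ ss u v → ∃ λ f′ →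
    Polynomial (length ss) (u ^ length ss) (λ x → rootProduct ss (u * x + v)) f′
  rootProduct-affine []       u v = _ , constant′ 1#
  rootProduct-affine (s ∷ ss) u v = _ ,
    mul (polynomial-resp refl (λ x → +-assoc _ _ _) (λ _ → refl) (affine u (v - s)))
        (proj₂ (rootProduct-affine ss u v))

  -- The truncated exponent is harmless: for `n = 0` the factor `ι n` is zero.
  power : ∀ n u → Polynomial n 1# (λ x → (x + u) ^ n) (λ x → ι n * (x + u) ^ (n ℕ.∸ 1))
  power zero u = constant (λ _ → refl) (λ _ → zeroˡ _)
  power (suc n) u = polynomial-resp (*-identityˡ _) (λ x → *-congʳ (+-congʳ (sym (*-identityˡ x))))
    (derivative n) (mul (affine 1# u) (power n u))
    where
    derivative : ∀ n x → ι (suc n) * (x + u) ^ n ≈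
                         1# * (x + u) ^ n + (1# * x + u) * (ι n * (x + u) ^ (n ℕ.∸ 1))
    derivative zero    x = solve 2 (λ x u → con (+ 1) :* con (+ 1) :=
      con (+ 1) :* con (+ 1) :+ (con (+ 1) :* x :+ u) :* (con (+ 0) :* con (+ 1))) refl x u
    derivative (suc n) x = begin
      ι (suc (suc n)) * (x + u) ^ suc n   ≈⟨ *-congʳ (1+× (suc n) 1#) ⟩
      (1# + ι (suc n)) * (x + u) ^ suc n  ≈⟨ solve 4 (λ x u i p →
        (con (+ 1) :+ i) :* ((x :+ u) :* p) := con (+ 1) :* ((x :+ u) :* p) :+ (con (+ 1) :* x :+ u) :* (i :* p))
        refl x u (ι (suc n)) ((x + u) ^ n) ⟩
      _                                   ∎

  module _ (cancel : ∀ {x y} → ¬ x ≈ 0# → x * y ≈ 0# → y ≈ 0#) where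

    private
      root-of-quotient : ∀ {f g : Carrier → Carrier} {s x} → (∀ x → f x ≈ (x - s) * g x) →
                         ¬ s ≈ x → f x ≈ 0# → g x ≈ 0#
      root-of-quotient f≈ s≉x fx≈0 =
        cancel (λ x-s≈0 → s≉x (sym (x-y≈0⇒x≈y _ _ x-s≈0))) (trans (sym (f≈ _)) fx≈0)

    -- Split off one root at a time. The second conclusion replaces the comparison of coefficients:
    -- a function that vanishes at enough nonzero points also vanishes at 0, where its constant
    -- coefficient can be read off.
    roots>degree : ∀ {xs} → Polynomial d a f f′ → Distinct xs → All (λ x → f x ≈ 0#) xs →
                   d ℕ.< length xs → a ≈ 0# × (∀ x → f x ≈ 0#)
    roots>degree (constant p _) _ (fs≈0 ∷ _) _ = a≈0 , λ x → trans (p x) a≈0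
      where a≈0 = trans (sym (p _)) fs≈0
    roots>degree {xs = s ∷ _} h@(horner _ _ _ _) (s∉xs ∷ xs!) (fs≈0 ∷ roots) (ℕ.s≤s d<n)
      with factor s h fs≈0
    ... | g , g′ , gp , f≈ , _ =
      a≈0 , λ x → trans (f≈ x) (trans (*-congˡ (g≈0 x)) (zeroʳ _))
      where
      rec = roots>degree gp xs! (All.zipWith (λ (s≉x , fx≈0) → root-of-quotient f≈ s≉x fx≈0) (s∉xs , roots)) d<n
      a≈0 = proj₁ rec
      g≈0 = proj₂ rec

    roots≤degree : ∀ {xs} → Polynomial d a f f′ → ¬ a ≈ 0# → Distinct xs →
                   All (λ x → f x ≈ 0#) xs → length xs ℕ.≤ d
    roots≤degree fp a≉0 xs! roots = ℕ.≮⇒≥ (λ d<n → a≉0 (proj₁ (roots>degree fp xs! roots d<n)))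

    factorisation : ∀ {xs} → Polynomial d a f f′ → Distinct xs → All (λ x → f x ≈ 0#) xs →
                    length xs ≡ d → ∀ x → f x ≈ a * rootProduct xs x
    factorisation {xs = []} (constant p _) _ _ ≡.refl x = trans (p x) (sym (*-identityʳ _))
    factorisation {a = a} {xs = s ∷ xs} h@(horner _ _ _ _) (s∉xs ∷ xs!) (fs≈0 ∷ roots) ≡.refl x
      with factor s h fs≈0
    ... | g , g′ , gp , f≈ , _ = begin
      _                               ≈⟨ f≈ x ⟩
      (x - s) * g x
        ≈⟨ *-congˡ (factorisation gp xs! (All.zipWith (λ (s≉x , fx≈0) → root-of-quotient f≈ s≉x fx≈0)
            (s∉xs , roots)) ≡.refl x) ⟩
      (x - s) * (a * rootProduct xs x)
        ≈⟨ solve 3 (λ y a p → y :* (a :* p) := a :* (y :* p)) refl (x - s) a (rootProduct xs x) ⟩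
      a * ((x - s) * rootProduct xs x) ∎

    DoubleRoot : (f f′ : Carrier → Carrier) → Carrier → Set ℓ
    DoubleRoot f f′ x = f x ≈ 0# × f′ x ≈ 0#

    private
      -- The quotient vanishes at `s` because `g s ≈ f′ s`. At another double root `x` first `g x`
      -- vanishes, and then `f′ x` reduces to `(x - s) * g′ x`.
      double-root : ∀ {s} → Polynomial (suc d) a f f′ → DoubleRoot f f′ s → ∃₂ λ g g′ →
        Polynomial d a g g′ × (∀ x → f x ≈ (x - s) * g x) × g s ≈ 0# ×
        (∀ {x} → ¬ s ≈ x → DoubleRoot f f′ x → DoubleRoot g g′ x)
      double-root {s = s} fp (fs≈0 , f′s≈0) with factor s fp fs≈0
      ... | g , g′ , gp , f≈ , f′≈ = g , g′ , gp , f≈ ,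
        trans (solve 3 (λ s g g′ → g := g :+ (s :- s) :* g′) refl s (g s) (g′ s)) (trans (sym (f′≈ s)) f′s≈0) ,
        λ {x} s≉x (fx≈0 , f′x≈0) →
          let gx≈0 = root-of-quotient f≈ s≉x fx≈0 in
          gx≈0 , root-of-quotient {f = λ x → (x - s) * g′ x} (λ _ → refl) s≉x
            (trans (sym (+-identityˡ _)) (trans (+-congʳ (sym gx≈0)) (trans (sym (f′≈ x)) f′x≈0)))

      double-root² : ∀ {s xs} → Polynomial (suc (suc d)) a f f′ →
        All (λ x → ¬ s ≈ x) xs → All (DoubleRoot f f′) (s ∷ xs) → ∃₂ λ g g′ →
        Polynomial d a g g′ × (∀ x → f x ≈ (x - s) * ((x - s) * g x)) × All (DoubleRoot g g′) xs
      double-root² {s = s} fp s∉xs (root ∷ roots) with double-root fp root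
      ... | g , g′ , gp , f≈ , gs≈0 , rest with factor s gp gs≈0
      ... | h , h′ , hp , g≈ , g′≈ = h , h′ , hp , (λ x → trans (f≈ x) (*-congˡ (g≈ x))) ,
        All.zipWith (λ {x} (s≉x , fx) →
          let gx≈0 , g′x≈0 = rest s≉x fx
              hx≈0 = root-of-quotient g≈ s≉x gx≈0
          in hx≈0 , root-of-quotient {f = λ x → (x - s) * h′ x} (λ _ → refl) s≉x
               (trans (sym (+-identityˡ _)) (trans (+-congʳ (sym hx≈0)) (trans (sym (g′≈ x)) g′x≈0))))
          (s∉xs , roots)

    doubleRoots≤degree : ∀ {xs} → Polynomial d a f f′ → ¬ a ≈ 0# → Distinct xs →
                         All (DoubleRoot f f′) xs → length xs ℕ.+ length xs ℕ.≤ d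
    doubleRoots≤degree fp a≉0 [] [] = ℕ.z≤n
    doubleRoots≤degree (constant p _) a≉0 (_ ∷ _) ((fs≈0 , _) ∷ _) =
      ⊥-elim (a≉0 (trans (sym (p _)) fs≈0))
    -- The quotient is the constant `a`, and the double root makes it vanish.
    doubleRoots≤degree {d = 1} fp a≉0 (_ ∷ _) (root ∷ _) with double-root fp root
    ... | _ , _ , constant p _ , _ , gs≈0 , _ = ⊥-elim (a≉0 (trans (sym (p _)) gs≈0))
    doubleRoots≤degree {d = suc (suc d)} {xs = _ ∷ xs} fp a≉0 (s∉xs ∷ xs!) roots
      with double-root² fp s∉xs roots
    ... | _ , _ , gp , _ , roots′ = ≡.subst (ℕ._≤ suc (suc d))
      (≡.cong suc (≡.sym (ℕ.+-suc (length xs) (length xs))))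
      (ℕ.s≤s (ℕ.s≤s (doubleRoots≤degree gp a≉0 xs! roots′)))

    double-factorisation : ∀ {xs} → Polynomial d a f f′ → Distinct xs →
      All (DoubleRoot f f′) xs → length xs ℕ.+ length xs ≡ d →
      ∀ x → f x ≈ a * (rootProduct xs x * rootProduct xs x)
    double-factorisation {xs = []} (constant p _) _ _ ≡.refl x =
      trans (p x) (solve 1 (λ a → a := a :* (con (+ 1) :* con (+ 1))) refl _)
    double-factorisation {a = a} {f = f} {f′ = f′} {xs = s ∷ xs} fp (s∉xs ∷ xs!) roots ≡.refl x
      with double-root² (≡.subst (λ d → Polynomial d a f f′) (≡.cong suc (ℕ.+-suc (length xs) (length xs))) fp)
                        s∉xs roots
    ... | g , g′ , gp , f≈ , roots′ = begin
      _                                   ≈⟨ f≈ x ⟩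
      (x - s) * ((x - s) * g x)           ≈⟨ *-congˡ (*-congˡ (double-factorisation gp xs! roots′ ≡.refl x)) ⟩
      (x - s) * ((x - s) * (a * (h * h)))
        ≈⟨ solve 3 (λ y a h → y :* (y :* (a :* (h :* h))) := a :* (y :* h :* (y :* h))) refl (x - s) a h ⟩
      a * ((x - s) * h * ((x - s) * h))   ∎
      where h = rootProduct xs x

-- Weighted sums of powers of translates, and their degrees.

module PowerSums {c ℓ} (R : CommutativeRing c ℓ) where
  open CommutativeRing R hiding (zero)
  open IntegerCoefficients R using (ι; 1+×; solve; con; _:+_; _:*_; _:=_)
  open PolynomialFunctions R
  open Exp commutativeSemiring using (_^_)
  open SetoidReasoning setoid

  powerSum : List (Carrier × Carrier) → ℕ → Carrier → Carrier
  powerSum []             n x = 0#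
  powerSum ((c , u) ∷ ps) n x = c * (x + u) ^ n + powerSum ps n x

  -- The coefficient of xⁿ⁻ʲ in `powerSum ps n` is the binomial coefficient n over j times
  -- `moment ps j`, so each further vanishing moment, starting with the zeroth, lowers the degree by
  -- one.
  moment : List (Carrier × Carrier) → ℕ → Carrier
  moment []             j = 0#
  moment ((c , u) ∷ ps) j = c * u ^ j + moment ps j

  -- Splitting one factor `x + u` off each power yields the sum with weights `c * u`. Moments shift
  -- by one, so the inductions on the exponent call the degree bound that assumes one vanishing
  -- moment less.
  reweight : List (Carrier × Carrier) → List (Carrier × Carrier)
  reweight = map λ (c , u) → c * u , u

  moment-reweight : ∀ ps j → moment (reweight ps) j ≈ moment ps (suc j)
  moment-reweight []             j = refl
  moment-reweight ((c , u) ∷ ps) j = +-cong (*-assoc c u (u ^ j)) (moment-reweight ps j)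

  powerSum-0 : ∀ ps x → powerSum ps 0 x ≈ moment ps 0
  powerSum-0 []       x = refl
  powerSum-0 (_ ∷ ps) x = +-congˡ (powerSum-0 ps x)

  powerSum-suc : ∀ ps n x → powerSum ps (suc n) x ≈ x * powerSum ps n x + powerSum (reweight ps) n x
  powerSum-suc []             n x = sym (trans (+-identityʳ _) (zeroʳ x))
  powerSum-suc ((c , u) ∷ ps) n x = trans (+-congˡ (powerSum-suc ps n x))
    (solve 6 (λ c u x p w w′ → c :* ((x :+ u) :* p) :+ (x :* w :+ w′) :=
                               x :* (c :* p :+ w) :+ (c :* u :* p :+ w′))
      refl c u x ((x + u) ^ n) (powerSum ps n x) (powerSum (reweight ps) n x))

  powerSum-1 : ∀ ps x → moment ps 0 ≈ 0# → powerSum ps 1 x ≈ moment ps 1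
  powerSum-1 ps x m₀≈0 = begin
    powerSum ps 1 x                                      ≈⟨ powerSum-suc ps 0 x ⟩
    x * powerSum ps 0 x + powerSum (reweight ps) 0 x
      ≈⟨ +-cong (*-congˡ (trans (powerSum-0 ps x) m₀≈0)) (powerSum-0 (reweight ps) x) ⟩
    x * 0# + moment (reweight ps) 0                      ≈⟨ +-cong (zeroʳ x) (moment-reweight ps 0) ⟩
    0# + moment ps 1                                     ≈⟨ +-identityˡ _ ⟩
    moment ps 1                                          ∎

  -- The product rule for the recursion `powerSum-suc`: the left side is the derivative that `add`
  -- and `times-x` produce in the two induction steps below.
  powerSum-derivative : ∀ ps n x →
    powerSum ps (suc n) x + x * (ι (suc n) * powerSum ps n x) + ι (suc n) * powerSum (reweight ps) n x ≈
    ι (suc (suc n)) * powerSum ps (suc n) x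
  powerSum-derivative ps n x = begin
    w₁ + x * (i * w) + i * w′
      ≈⟨ solve 5 (λ x i w w′ w₁ → w₁ :+ x :* (i :* w) :+ i :* w′ :=
          w₁ :+ i :* (x :* w :+ w′)) refl x i w w′ w₁ ⟩
    w₁ + i * (x * w + w′)     ≈⟨ +-congˡ (*-congˡ (powerSum-suc ps n x)) ⟨
    w₁ + i * w₁               ≈⟨ solve 2 (λ i w → w :+ i :* w := (con (+ 1) :+ i) :* w) refl i w₁ ⟩
    (1# + i) * w₁             ≈⟨ *-congʳ (1+× (suc n) 1#) ⟨
    ι (suc (suc n)) * w₁      ∎
    where
    i = ι (suc n)
    w = powerSum ps n x
    w₁ = powerSum ps (suc n) x
    w′ = powerSum (reweight ps) n x

  powerSum-degree : ∀ ps n →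
    Polynomial n (moment ps 0) (powerSum ps n) (λ x → ι n * powerSum ps (n ℕ.∸ 1) x)
  powerSum-degree [] n =
    polynomial-resp refl (λ _ → refl) (λ _ → zeroʳ _) (zeros n)
    where
    zeros : ∀ n → Polynomial n 0# (λ _ → 0#) (λ _ → 0#)
    zeros zero    = constant′ 0#
    zeros (suc n) = raise (zeros n)
  powerSum-degree ((c , u) ∷ ps) n = polynomial-resp refl (λ _ → refl)
    (λ x → solve 4 (λ c i p w → i :* (c :* p :+ w) := c :* (i :* p) :+ i :* w) refl
                 c (ι n) ((x + u) ^ (n ℕ.∸ 1)) (powerSum ps (n ℕ.∸ 1) x))
    (add (scale c (power n u)) (powerSum-degree ps n))

  powerSum-degree₁ : ∀ ps n → moment ps 0 ≈ 0# →
    Polynomial n (ι (suc n) * moment ps 1) (powerSum ps (suc n)) (λ x → ι (suc n) * powerSum ps n x)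
  powerSum-degree₁ ps zero m₀≈0 = constant
    (λ x → trans (powerSum-1 ps x m₀≈0) (sym (*-identityˡ _)))
    (λ x → trans (*-identityˡ _) (trans (powerSum-0 ps x) m₀≈0))
  powerSum-degree₁ ps (suc n) m₀≈0 = polynomial-resp
    (begin
      ι (suc n) * moment ps 1 + moment (reweight ps) 0 ≈⟨ +-congˡ (moment-reweight ps 0) ⟩
      ι (suc n) * moment ps 1 + moment ps 1
        ≈⟨ solve 2 (λ i m → i :* m :+ m := (con (+ 1) :+ i) :* m) refl (ι (suc n)) (moment ps 1) ⟩
      (1# + ι (suc n)) * moment ps 1                   ≈⟨ *-congʳ (1+× (suc n) 1#) ⟨
      ι (suc (suc n)) * moment ps 1                    ∎)
    (powerSum-suc ps (suc n)) (λ x → sym (powerSum-derivative ps n x))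
    (add (times-x (powerSum-degree₁ ps n m₀≈0)) (powerSum-degree (reweight ps) (suc n)))

  -- The binomial coefficient n + 2 over 2, built by Pascal's rule so that nothing is divided by 2.
  triangular : ℕ → Carrier
  triangular zero    = 1#
  triangular (suc n) = triangular n + ι (suc (suc n))

  2*triangular : ∀ n → ι 2 * triangular n ≈ ι (suc n) * ι (suc (suc n))
  2*triangular zero    = solve 0 (con (+ 2) :* con (+ 1) := con (+ 1) :* con (+ 2)) refl
  2*triangular (suc n) = begin
    ι 2 * (triangular n + j)      ≈⟨ distribˡ _ _ _ ⟩
    ι 2 * triangular n + ι 2 * j  ≈⟨ +-congʳ (2*triangular n) ⟩
    i * j + ι 2 * j
      ≈⟨ solve 2 (λ i j → i :* j :+ con (+ 2) :* j := j :* (con (+ 1) :+ (con (+ 1) :+ i))) refl i j ⟩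
    j * (1# + (1# + i))           ≈⟨ *-congˡ (trans (1+× (suc (suc n)) 1#) (+-congˡ (1+× (suc n) 1#))) ⟨
    j * ι (suc (suc (suc n)))     ∎
    where
    i = ι (suc n)
    j = ι (suc (suc n))

  powerSum-degree₂ : ∀ ps n → moment ps 0 ≈ 0# → moment ps 1 ≈ 0# →
    Polynomial n (triangular n * moment ps 2) (powerSum ps (suc (suc n)))
               (λ x → ι (suc (suc n)) * powerSum ps (suc n) x)
  powerSum-degree₂ ps zero m₀≈0 m₁≈0 = constant
    (λ x → begin
      powerSum ps 2 x                                   ≈⟨ powerSum-suc ps 1 x ⟩
      x * powerSum ps 1 x + powerSum (reweight ps) 1 x
        ≈⟨ +-cong (*-congˡ (trans (powerSum-1 ps x m₀≈0) m₁≈0))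
                  (trans (powerSum-1 (reweight ps) x (trans (moment-reweight ps 0) m₁≈0)) (moment-reweight ps 1)) ⟩
      x * 0# + moment ps 2
        ≈⟨ solve 2 (λ x m → x :* con (+ 0) :+ m := con (+ 1) :* m) refl x (moment ps 2) ⟩
      1# * moment ps 2                                  ∎)
    (λ x → trans (*-congˡ (trans (powerSum-1 ps x m₀≈0) m₁≈0)) (zeroʳ _))
  powerSum-degree₂ ps (suc n) m₀≈0 m₁≈0 = polynomial-resp
    (trans (+-congˡ (*-congˡ (moment-reweight ps 1))) (sym (distribʳ _ _ _)))
    (powerSum-suc ps (suc (suc n))) (λ x → sym (powerSum-derivative ps (suc n) x))
    (add (times-x (powerSum-degree₂ ps n m₀≈0 m₁≈0))
         (powerSum-degree₁ (reweight ps) (suc n) (trans (moment-reweight ps 0) m₁≈0)))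

  module _ {t : ℕ} {x : Carrier} where
    powerSum-unity : ∀ {ps} → All (λ (c , u) → (x + u) ^ t ≈ 1#) ps → powerSum ps t x ≈ moment ps 0
    powerSum-unity []       = refl
    powerSum-unity (u ∷ us) = +-cong (*-congˡ u) (powerSum-unity us)

    powerSum-suc-unity : ∀ {ps} → All (λ (c , u) → (x + u) ^ t ≈ 1#) ps →
                         powerSum ps (suc t) x ≈ x * moment ps 0 + moment ps 1
    powerSum-suc-unity [] = sym (trans (+-identityʳ _) (zeroʳ x))
    powerSum-suc-unity {(c , u) ∷ ps} (p ∷ us) = begin
      c * ((x + u) * (x + u) ^ t) + powerSum ps (suc t) x  ≈⟨ +-cong (*-congˡ (*-congˡ p)) (powerSum-suc-unity us) ⟩
      c * ((x + u) * 1#) + (x * m₀ + m₁)                   ≈⟨ solve 5 (λ c u x m₀ m₁ →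
        c :* ((x :+ u) :* con (+ 1)) :+ (x :* m₀ :+ m₁) :=
            x :* (c :* con (+ 1) :+ m₀) :+ (c :* (u :* con (+ 1)) :+ m₁))
        refl c u x m₀ m₁ ⟩
      x * (c * 1# + m₀) + (c * (u * 1#) + m₁)              ∎
      where
      m₀ = moment ps 0
      m₁ = moment ps 1

  -- Binomial coefficients in the ring, and tails of the binomial expansion.

  binomial : ℕ → ℕ → Carrier
  binomial n       zero    = 1#
  binomial zero    (suc i) = 0#
  binomial (suc n) (suc i) = binomial n i + binomial n (suc i)

  binomial-n-1 : ∀ n → binomial n 1 ≈ ι n
  binomial-n-1 zero    = refl
  binomial-n-1 (suc n) = trans (+-congˡ (binomial-n-1 n)) (sym (1+× n 1#))

  -- The usual quotient of neighbouring coefficients, freed of division and of the subtraction n -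
  -- i; it therefore holds in every characteristic and also for i > n.
  binomial-absorption : ∀ n i → ι (suc i) * binomial n (suc i) + ι i * binomial n i ≈ ι n * binomial n i
  binomial-absorption zero zero =
    solve 0 (con (+ 1) :* con (+ 0) :+ con (+ 0) :* con (+ 1) := con (+ 0) :* con (+ 1)) refl
  binomial-absorption zero (suc i) =
    solve 2 (λ i j → i :* con (+ 0) :+ j :* con (+ 0) := con (+ 0) :* con (+ 0)) refl (ι (suc (suc i))) (ι (suc i))
  binomial-absorption (suc n) zero = begin
    1# * binomial (suc n) 1 + 0# * 1#
      ≈⟨ solve 1 (λ b → con (+ 1) :* b :+ con (+ 0) :* con (+ 1) := b :* con (+ 1)) refl _ ⟩
    binomial (suc n) 1 * 1#            ≈⟨ *-congʳ (binomial-n-1 (suc n)) ⟩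
    ι (suc n) * 1#                     ∎
  binomial-absorption (suc n) (suc i) = begin
    ι (suc (suc i)) * (b₁ + b₂) + ι (suc i) * (b₀ + b₁)
      ≈⟨ +-congˡ (*-congʳ (1+× i 1#)) ⟩
    ι (suc (suc i)) * (b₁ + b₂) + (1# + ι i) * (b₀ + b₁)
      ≈⟨ +-congʳ (*-congʳ (1+× (suc i) 1#)) ⟩
    (1# + ι (suc i)) * (b₁ + b₂) + (1# + ι i) * (b₀ + b₁)
      ≈⟨ solve 5 (λ i j b₀ b₁ b₂ →
        (con (+ 1) :+ j) :* (b₁ :+ b₂) :+ (con (+ 1) :+ i) :* (b₀ :+ b₁) :=
        ((con (+ 1) :+ j) :* b₂ :+ j :* b₁) :+ ((con (+ 1) :+ i) :* b₁ :+ i :* b₀) :+ (b₀ :+ b₁))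
            refl (ι i) (ι (suc i)) b₀ b₁ b₂ ⟩
    ((1# + ι (suc i)) * b₂ + ι (suc i) * b₁) + ((1# + ι i) * b₁ + ι i * b₀) + (b₀ + b₁)
      ≈⟨ +-congʳ (+-cong (+-congʳ (*-congʳ (1+× (suc i) 1#))) (+-congʳ (*-congʳ (1+× i 1#)))) ⟨
    (ι (suc (suc i)) * b₂ + ι (suc i) * b₁) + (ι (suc i) * b₁ + ι i * b₀) + (b₀ + b₁)
      ≈⟨ +-congʳ (+-cong (binomial-absorption n (suc i)) (binomial-absorption n i)) ⟩
    ι n * b₁ + ι n * b₀ + (b₀ + b₁)
      ≈⟨ solve 3 (λ n b₀ b₁ → n :* b₁ :+ n :* b₀ :+ (b₀ :+ b₁) := (con (+ 1) :+ n) :* (b₀ :+ b₁)) refl (ι n) b₀ b₁ ⟩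
    (1# + ι n) * (b₀ + b₁)
      ≈⟨ *-congʳ (1+× n 1#) ⟨
    ι (suc n) * (b₀ + b₁) ∎
    where
    b₀ = binomial n i
    b₁ = binomial n (suc i)
    b₂ = binomial n (suc (suc i))

  binomial-vanishes : ∀ {n i} → n ℕ.< i → binomial n i ≈ 0#
  binomial-vanishes {zero}  {suc i} _           = refl
  binomial-vanishes {suc n} {suc i} (ℕ.s≤s n<i) =
    trans (+-cong (binomial-vanishes n<i) (binomial-vanishes (ℕ.m≤n⇒m≤1+n n<i))) (+-identityˡ 0#)

  binomial-diagonal : ∀ n → binomial n n ≈ 1#
  binomial-diagonal zero    = refl
  binomial-diagonal (suc n) =
    trans (+-cong (binomial-diagonal n) (binomial-vanishes (ℕ.n<1+n n))) (+-identityʳ 1#)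

  -- tail m n x = Σ_{i ≥ m} (n choose i) x^(i - m)
  tail : ℕ → ℕ → Carrier → Carrier
  tail zero    n       x = (1# + x) ^ n
  tail (suc m) zero    x = 0#
  tail (suc m) (suc n) x = tail m n x + tail (suc m) n x

  tail-unfold : ∀ m n x → tail m n x ≈ binomial n m + x * tail (suc m) n x
  tail-unfold zero zero x = solve 1 (λ x → con (+ 1) := con (+ 1) :+ x :* con (+ 0)) refl x
  tail-unfold (suc m) zero x = solve 1 (λ x → con (+ 0) := con (+ 0) :+ x :* con (+ 0)) refl x
  tail-unfold zero (suc n) x = begin
    (1# + x) * p            ≈⟨ solve 2 (λ x p → (con (+ 1) :+ x) :* p := x :* p :+ p) refl x p ⟩
    x * p + p               ≈⟨ +-congˡ (tail-unfold zero n x) ⟩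
    x * p + (1# + x * tail 1 n x)
      ≈⟨ solve 3 (λ x p r → x :* p :+ (con (+ 1) :+ x :* r) :=
          con (+ 1) :+ x :* (p :+ r)) refl x p (tail 1 n x) ⟩
    1# + x * (p + tail 1 n x) ∎
    where p = (1# + x) ^ n
  tail-unfold (suc m) (suc n) x = trans (+-cong (tail-unfold m n x) (tail-unfold (suc m) n x))
    (solve 5 (λ x b b′ r r′ → (b :+ x :* r) :+ (b′ :+ x :* r′) := (b :+ b′) :+ x :* (r :+ r′)) refl
      x _ _ (tail (suc m) n x) (tail (suc (suc m)) n x))

  tail-vanishes : ∀ {m n} x → n ℕ.< m → tail m n x ≈ 0#
  tail-vanishes {suc m} {zero}  x _ = refl
  tail-vanishes {suc m} {suc n} x (ℕ.s≤s n<m) =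
    trans (+-cong (tail-vanishes x n<m) (tail-vanishes x (ℕ.m≤n⇒m≤1+n n<m))) (+-identityˡ _)

  -- The factor `w` will be 1 and -1, for the expansions of (1 + z)ⁿ and (1 - z)ⁿ.
  tail-degree : ∀ r m w → Degree≤ r (λ x → tail m (m ℕ.+ r) (w * x))
  tail-degree zero m w = binomial n m , _ , constant
    (λ x → begin
      tail m n (w * x)                                      ≈⟨ tail-unfold m n (w * x) ⟩
      binomial n m + w * x * tail (suc m) n (w * x)
        ≈⟨ +-congˡ (*-congˡ (tail-vanishes (w * x) (ℕ.≤-reflexive (≡.cong suc (ℕ.+-identityʳ m))))) ⟩
      binomial n m + w * x * 0#
        ≈⟨ solve 3 (λ b w x → b :+ w :* x :* con (+ 0) := b) refl (binomial n m) w x ⟩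
      binomial n m                                          ∎)
    (λ _ → refl)
    where n = m ℕ.+ zero
  tail-degree (suc r) m w with tail-degree r (suc m) w
  ... | a , _ , p = w * a , _ , horner (binomial (m ℕ.+ suc r) m)
    (polynomial-resp refl (λ x → *-congˡ (reflexive (≡.cong (λ n → tail (suc m) n (w * x))
        (ℕ.+-suc m r)))) (λ _ → refl) (scale w p))
    (λ x → trans (tail-unfold m (m ℕ.+ suc r) (w * x))
      (solve 4 (λ b w x y → b :+ w :* x :* y := b :+ x :* (w :* y)) refl _ w x _))
    (λ _ → refl)

-- The coefficient comparison for a summand with two elements.

module TwoTranslates {c ℓ} (R : CommutativeRing c ℓ) where
  open CommutativeRing R hiding (zero)
  open RingProperties ring using (-1*x≈-x) renaming (x≈y⇒x∙y⁻¹≈ε to x≈y⇒x-y≈0)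
  open IntegerCoefficients R using (ι; 1+×; solve; con; _:+_; _:*_; _:-_; :-_; _:=_)
  open PolynomialFunctions R
  open PowerSums R
  open Exp commutativeSemiring using (_^_; ^-congˡ)
  open UniqueSetoid setoid using () renaming (Unique to Distinct)
  open SetoidReasoning setoid

  module _ (cancel : ∀ {x y} → ¬ x ≈ 0# → x * y ≈ 0# → y ≈ 0#) where

    private
      +0 : ∀ {x y} → x ≈ 0# → y ≈ 0# → x + y ≈ 0#
      +0 p q = trans (+-cong p q) (+-identityˡ 0#)

      *0 : ∀ x {y} → y ≈ 0# → x * y ≈ 0#
      *0 x p = trans (*-congˡ p) (zeroʳ x)

    -- The two hypotheses force n ≈ 5, hence the values 10, 10, 5, 1 of the
    -- binomial coefficients, for which the second expression is 10 ≈ 2 n.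
    binomial-contradiction : ∀ n →
      let b = binomial n
          m = ι n in
      ¬ ι 2 ≈ 0# → ¬ m - 1# ≈ 0# → ¬ m ≈ 0# →
      ι 2 * m * b 3 - b 2 * b 2 ≈ 0# →
      ι 2 * m * b 5 - ι 2 * b 2 * b 4 + b 3 * b 3 ≈ 0# → ⊥
    binomial-contradiction n 2≉0 m≉1 m≉0 e₂ e₄ = m≉0 (cancel 2≉0 (begin
      ι 2 * m ≈⟨ solve 5 (λ m x y z w → con (+ 2) :* m :=
          (con (+ 2) :* m :* w :- con (+ 2) :* x :* z :+ y :* y)
          :+ (:- (con (+ 2) :* m) :* (w :- con (+ 1)) :+ (con (+ 2) :* x :* (z :- con (+ 5))
          :+ (con (+ 10) :* (x :- con (+ 10)) :+ (:- (y :+ con (+ 10))) :* (y :- con (+ 10))))))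
          refl m b₂ b₃ b₄ b₅ ⟩
      _       ≈⟨ +0 e₄ (+0 (*0 _ b₅≈1) (+0 (*0 _ b₄≈5) (+0 (*0 _ b₂≈10) (*0 _ b₃≈10)))) ⟩
      0#      ∎))
      where
      m  = ι n
      b₂ = binomial n 2
      b₃ = binomial n 3
      b₄ = binomial n 4
      b₅ = binomial n 5

      h₂ : ι 2 * b₂ - m * (m - 1#) ≈ 0#
      h₂ = begin
        ι 2 * b₂ - m * (m - 1#)
          ≈⟨ solve 2 (λ b m → con (+ 2) :* b :- m :* (m :- con (+ 1)) :=
              (con (+ 2) :* b :+ con (+ 1) :* m) :- m :* m) refl b₂ m ⟩
        ι 2 * b₂ + ι 1 * m - m * m            ≈⟨ +-cong (+-congˡ (*-congˡ b₁)) (-‿cong (*-congˡ b₁)) ⟨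
        ι 2 * b₂ + ι 1 * binomial n 1 - m * binomial n 1  ≈⟨ x≈y⇒x-y≈0 (binomial-absorption n 1) ⟩
        0#                                    ∎
        where b₁ = binomial-n-1 n

      absorbed : ∀ {j k x y} → j * y + k * x ≈ m * x → j * y - (m - k) * x ≈ 0#
      absorbed {j} {k} {x} {y} eq = trans
        (solve 5 (λ j k m x y → j :* y :- (m :- k) :* x := (j :* y :+ k :* x) :- m :* x) refl j k m x y)
        (x≈y⇒x-y≈0 eq)

      h₃ : ι 3 * b₃ - (m - ι 2) * b₂ ≈ 0#
      h₃ = absorbed (binomial-absorption n 2)

      h₄ : ι 4 * b₄ - (m - ι 3) * b₃ ≈ 0#
      h₄ = absorbed (binomial-absorption n 3)

      h₅ : ι 5 * b₅ - (m - ι 4) * b₄ ≈ 0#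
      h₅ = absorbed (binomial-absorption n 4)

      b₂≉0 : ¬ b₂ ≈ 0#
      b₂≉0 b₂≈0 = m≉1 (cancel m≉0 (begin
        m * (m - 1#)
          ≈⟨ solve 2 (λ m b → m :* (m :- con (+ 1)) :=
              con (+ 2) :* b :+ con (ℤ.-[1+ 0 ]) :* (con (+ 2) :* b :- m :* (m :- con (+ 1)))) refl m b₂ ⟩
        _                     ≈⟨ +0 (*0 _ b₂≈0) (*0 _ h₂) ⟩
        0#                    ∎))

      -- In three times `e₂`, replace 3 b₃ by (m - 2) b₂ and cancel b₂.
      k : ι 2 * m * (m - ι 2) - ι 3 * b₂ ≈ 0#
      k = cancel b₂≉0 (begin
        _  ≈⟨ solve 3 (λ m x y → x :* (con (+ 2) :* m :* (m :- con (+ 2)) :- con (+ 3) :* x) :=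
                con (+ 3) :* (con (+ 2) :* m :* y :- x :* x)
                    :+ (:- (con (+ 2) :* m)) :* (con (+ 3) :* y :- (m :- con (+ 2)) :* x)) refl m b₂ b₃ ⟩
        _  ≈⟨ +0 (*0 _ e₂) (*0 _ h₃) ⟩
        0# ∎)

      m≈5 : m - ι 5 ≈ 0#
      m≈5 = cancel m≉0 (begin
        _  ≈⟨ solve 2 (λ m x → m :* (m :- con (+ 5)) :=
                con (+ 2) :* (con (+ 2) :* m :* (m :- con (+ 2)) :- con (+ 3) :* x) :+ con (+ 3) :* (con
                    (+ 2) :* x :- m :* (m :- con (+ 1)))) refl m b₂ ⟩
        _  ≈⟨ +0 (*0 _ k) (*0 _ h₂) ⟩
        0# ∎)

      b₂≈10 : b₂ - ι 10 ≈ 0#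
      b₂≈10 = cancel 2≉0 (begin
        _  ≈⟨ solve 2 (λ m x → con (+ 2) :* (x :- con (+ 10)) :=
                (con (+ 2) :* x :- m :* (m :- con (+ 1))) :+ (m :+ con (+ 4)) :* (m :- con (+ 5))) refl m b₂ ⟩
        _  ≈⟨ +0 h₂ (*0 _ m≈5) ⟩
        0# ∎)

      -- `h₃` would require division by 3, which may be zero; `e₂` requires only division by 2 and
      -- `m`.
      b₃≈10 : b₃ - ι 10 ≈ 0#
      b₃≈10 = cancel m≉0 (cancel 2≉0 (begin
        _  ≈⟨ solve 3 (λ m x y → con (+ 2) :* (m :* (y :- con (+ 10))) :=
                (con (+ 2) :* m :* y :- x :* x) :+ ((x :+ con (+ 10)) :* (x :- con (+ 10))
                    :+ (:- con (+ 20)) :* (m :- con (+ 5)))) refl m b₂ b₃ ⟩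
        _  ≈⟨ +0 e₂ (+0 (*0 _ b₂≈10) (*0 _ m≈5)) ⟩
        0# ∎))

      b₄≈5 : b₄ - ι 5 ≈ 0#
      b₄≈5 = cancel 2≉0 (cancel 2≉0 (begin
        _  ≈⟨ solve 3 (λ m y z → con (+ 2) :* (con (+ 2) :* (z :- con (+ 5))) :=
                (con (+ 4) :* z :- (m :- con (+ 3)) :* y)
                    :+ (y :* (m :- con (+ 5)) :+ con (+ 2) :* (y :- con (+ 10)))) refl m b₃ b₄ ⟩
        _  ≈⟨ +0 h₄ (+0 (*0 _ m≈5) (*0 _ b₃≈10)) ⟩
        0# ∎))

      -- The factor 5 in `h₅` is `m` by now, and `m` is nonzero.
      b₅≈1 : b₅ - ι 1 ≈ 0#
      b₅≈1 = cancel m≉0 (begin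
        _  ≈⟨ solve 3 (λ m z w → m :* (w :- con (+ 1)) :=
                (con (+ 5) :* w :- (m :- con (+ 4)) :* z) :+ ((w :+ z :- con (+ 1)) :* (m :- con (+ 5))
                    :+ (z :- con (+ 5)))) refl m b₄ b₅ ⟩
        _  ≈⟨ +0 h₅ (+0 (*0 _ m≈5) b₄≈5) ⟩
        0# ∎)

    private
      variable
        d e : ℕ
        f g : Carrier → Carrier

      constant≤ : ∀ a → Degree≤ 0 (λ _ → a)
      constant≤ a = _ , _ , constant′ a

      pad : ∀ k → Degree≤ d f → Degree≤ (k ℕ.+ d) f
      pad zero    p = p
      pad (suc k) p = let _ , _ , q = pad k p in _ , _ , raise q

      widen : d ℕ.≤ e → Degree≤ d f → Degree≤ e f
      widen {d} {e} {f} d≤e p = ≡.subst (λ e → Degree≤ e f) (ℕ.m∸n+n≡m d≤e) (pad (e ℕ.∸ d) p)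

      _⊞_ : Degree≤ d f → Degree≤ d g → Degree≤ d (λ x → f x + g x)
      (_ , _ , p) ⊞ (_ , _ , q) = _ , _ , add p q

      _⊠_ : Degree≤ d f → Degree≤ e g → Degree≤ (d ℕ.+ e) (λ x → f x * g x)
      (_ , _ , p) ⊠ (_ , _ , q) = _ , _ , mul p q

      k+x*_ : Degree≤ d f → ∀ {k} → Degree≤ (suc d) (λ x → k + x * f x)
      (k+x* (_ , _ , p)) {k} = _ , _ , horner k p (λ _ → refl) (λ _ → refl)

      monomial : ∀ r → Degree≤ r (λ x → x ^ r)
      monomial zero    = _ , _ , constant′ 1#
      monomial (suc r) = let _ , _ , p = monomial r in _ , _ , times-x p

    -- The expansions of (1 + z)ⁿ - 1 and 1 - (1 - z)ⁿ differ only in the signs of their even terms.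
    -- In the difference of the two sides of the identity the z² terms cancel, z³ and z⁵ do not
    -- occur, and z⁴ and z⁶ carry `e₂` and `e₄`. The first term with `δ` is that of zᵗ⁺², and t + 2
    -- ≥ 7.
    translates-contradiction : ∀ {t n} r δ {zs} → t ≡ 5 ℕ.+ r → n ≡ suc t →
      ¬ ι 2 ≈ 0# → ¬ ι t ≈ 0# → ¬ ι n ≈ 0# →
      Distinct zs → All (λ z → ¬ z ≈ 0#) zs → t ℕ.+ t ℕ.≤ length zs →
      (∀ z → ¬ z ≈ 0# → ((1# + z) ^ n - 1# - δ * z ^ n) * (1# - (1# - z) ^ n - δ * z ^ n) ≈
                        ι n * z * (1# - δ * z ^ t) * (ι n * z * (1# - δ * z ^ t))) → ⊥
    translates-contradiction {t} {n} r δ {zs} t≡5+r n≡1+t 2≉0 t≉0 n≉0 zs! zs≉0 2t≤ identity =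
      binomial-contradiction n 2≉0 n≉1 n≉0 e₂≈0 e₄≈0
      where
      n≡6+r : n ≡ 6 ℕ.+ r
      n≡6+r = ≡.trans n≡1+t (≡.cong suc t≡5+r)

      m = ι n
      b = binomial n

      -- z⁶ X and z⁶ X̃ are the parts of the two factors beyond degree 5, and z⁶ Y = δ zⁿ. `Q`
      -- collects all terms of the difference from z⁷ on, divided by z⁷; its degree is at most 2 n -
      -- 7 = 5 + 2 r.
      X X̃ Y Q : Carrier → Carrier
      X z = tail 6 n (1# * z) + (- 1#) * Y z
      X̃ z = (- 1#) * tail 6 n ((- 1#) * z) + (- 1#) * Y z
      Y z = δ * z ^ r

      e₂ = ι 2 * m * b 3 - b 2 * b 2
      e₄ = ι 2 * m * b 5 - ι 2 * b 2 * b 4 + b 3 * b 3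
      e₆ = ι 2 * b 3 * b 5 - b 4 * b 4

      Q z = (0# + z * (e₆ + z * (0# + z * (b 5 * b 5))))
            + (m + z * (b 2 + z * (b 3 + z * (b 4 + z * b 5)))) * X̃ z
            + (m + z * ((- b 2) + z * (b 3 + z * ((- b 4) + z * b 5)))) * X z
            + (0# + z * (0# + z * (0# + z * (0# + z * (0# + z * (X z * X̃ z))))))
            + (- (m * m)) * ((- ι 2) * Y z + (0# + z * (0# + z * (0# + z * (0# + z * (0# + z * (Y z * Y z)))))))

      n≉1 : ¬ m - 1# ≈ 0#
      n≉1 m≈1 = t≉0 (begin
        ι t            ≈⟨ solve 1 (λ i → i := con (+ 1) :+ i :- con (+ 1)) refl (ι t) ⟩
        1# + ι t - 1#  ≈⟨ +-congʳ (trans (reflexive (≡.cong ι n≡1+t)) (1+× t 1#)) ⟨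
        m - 1#         ≈⟨ m≈1 ⟩
        0#             ∎)

      expand : ∀ w → tail 0 n w ≈ 1# + w * (m + w * (b 2 + w * (b 3 + w * (b 4 + w * (b 5 + w * tail 6 n w)))))
      expand w = unfold 0 (*-congˡ (trans (tail-unfold 1 n w) (+-cong (binomial-n-1 n) (*-congˡ
        (unfold 2 (*-congˡ (unfold 3 (*-congˡ (unfold 4 (*-congˡ (tail-unfold 5 n w)))))))))))
        where
        unfold : ∀ i {y} → w * tail (suc i) n w ≈ y → tail i n w ≈ b i + y
        unfold i eq = trans (tail-unfold i n w) (+-congˡ eq)

      Y≤ : Degree≤ r Y
      Y≤ = let _ , _ , p = monomial r in _ , _ , scale δ p

      -Y≤ : Degree≤ r (λ z → (- 1#) * Y z)
      -Y≤ = let _ , _ , p = Y≤ in _ , _ , scale (- 1#) p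

      tail≤ : ∀ w → Degree≤ r (λ x → tail 6 n (w * x))
      tail≤ w = ≡.subst (λ n → Degree≤ r (λ x → tail 6 n (w * x))) (≡.sym n≡6+r) (tail-degree r 6 w)

      X≤ : Degree≤ r X
      X≤ = tail≤ 1# ⊞ -Y≤

      X̃≤ : Degree≤ r X̃
      X̃≤ = (constant≤ (- 1#) ⊠ tail≤ (- 1#)) ⊞ -Y≤

      D = 5 ℕ.+ (r ℕ.+ r)

      quartic : ∀ {k₀ k₁ k₂ k₃ k₄} → Degree≤ 4 (λ z → k₀ + z * (k₁ + z * (k₂ + z * (k₃ + z * k₄))))
      quartic = k+x* k+x* k+x* k+x* constant≤ _

      Q≤ : Degree≤ D Q
      Q≤ = ((((widen (ℕ.m≤m+n 3 _) (k+x* k+x* k+x* constant≤ _)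
               ⊞ widen 4+r≤D (quartic ⊠ X̃≤))
               ⊞ widen 4+r≤D (quartic ⊠ X≤))
               ⊞ (k+x* k+x* k+x* k+x* k+x* (X≤ ⊠ X̃≤)))
               ⊞ (constant≤ _ ⊠ (widen (ℕ.≤-trans (ℕ.m≤m+n r r) (ℕ.m≤n+m _ 5)) (constant≤ _ ⊠ Y≤)
                                    ⊞ (k+x* k+x* k+x* k+x* k+x* (Y≤ ⊠ Y≤)))))
        where
        4+r≤D : 4 ℕ.+ r ℕ.≤ D
        4+r≤D = ℕ.≤-trans (ℕ.+-monoʳ-≤ 4 (ℕ.m≤m+n r r)) (ℕ.n≤1+n _)

      vanishing : ∀ z → ¬ z ≈ 0# → e₂ + z * (0# + z * (e₄ + z * Q z)) ≈ 0#
      vanishing z z≉0 = cancel z≉0 (cancel z≉0 (cancel z≉0 (cancel z≉0 (begin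
        z * (z * (z * (z * (e₂ + z * (0# + z * (e₄ + z * Q z))))))
          ≈⟨ solve 9 (λ z m b₂ b₃ b₄ b₅ p p̃ y →
               let x = p :+ :- con (+ 1) :* y
                   x̃ = :- con (+ 1) :* p̃ :+ :- con (+ 1) :* y
                   e₂ = con (+ 2) :* m :* b₃ :- b₂ :* b₂
                   e₄ = con (+ 2) :* m :* b₅ :- con (+ 2) :* b₂ :* b₄ :+ b₃ :* b₃
                   e₆ = con (+ 2) :* b₃ :* b₅ :- b₄ :* b₄
                   o = con (+ 0)
                   v = con (+ 1) :* z
                   w = :- con (+ 1) :* z
                   z⁵ = z :* (z :* (z :* (z :* z)))
                   q = (o :+ z :* (e₆ :+ z :* (o :+ z :* (b₅ :* b₅))))
                      :+ (m :+ z :* (b₂ :+ z :* (b₃ :+ z :* (b₄ :+ z :* b₅)))) :* x̃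
                      :+ (m :+ z :* (:- b₂ :+ z :* (b₃ :+ z :* (:- b₄ :+ z :* b₅)))) :* x
                      :+ (o :+ z :* (o :+ z :* (o :+ z :* (o :+ z :* (o :+ z :* (x :* x̃))))))
                      :+ :- (m :* m) :* (:- con (+ 2) :* y
                      :+ (o :+ z :* (o :+ z :* (o :+ z :* (o :+ z :* (o :+ z :* (y :* y)))))))
               in z :* (z :* (z :* (z :* (e₂ :+ z :* (o :+ z :* (e₄ :+ z :* q)))))) :=
                 (con (+ 1) :+ v :* (m :+ v :* (b₂ :+ v :* (b₃ :+ v :* (b₄ :+ v :* (b₅ :+ v :* p)))))
                   :- con (+ 1) :- z :* z⁵ :* y)
                 :* (con (+ 1) :- (con (+ 1) :+ w :* (m :+ w :* (b₂ :+ w :* (b₃ :+ w :* (b₄ :+ w :*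
                 (b₅ :+ w :* p̃))))))
                   :- z :* z⁵ :* y)
                 :- m :* z :* (con (+ 1) :- z⁵ :* y) :* (m :* z :* (con (+ 1) :- z⁵ :* y)))
               refl z m (b 2) (b 3) (b 4) (b 5) (tail 6 n (1# * z)) (tail 6 n ((- 1#) * z)) (δ * z ^ r) ⟩
        (P v (tail 6 n v) - 1# - z * z⁵ * Y z) * (1# - P w (tail 6 n w) - z * z⁵ * Y z)
          - m * z * (1# - z⁵ * Y z) * (m * z * (1# - z⁵ * Y z))
          ≈⟨ +-cong (*-cong (+-cong (+-congʳ P₊) (-‿cong zⁿ)) (+-cong (+-congˡ (-‿cong P₋)) (-‿cong zⁿ)))
                    (-‿cong (*-cong zᵗ zᵗ)) ⟩
        ((1# + z) ^ n - 1# - δ * z ^ n) * (1# - (1# - z) ^ n - δ * z ^ n)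
          - m * z * (1# - δ * z ^ t) * (m * z * (1# - δ * z ^ t))
          ≈⟨ x≈y⇒x-y≈0 (identity z z≉0) ⟩
        0# ∎))))
        where
        v = 1# * z
        w = (- 1#) * z
        z⁵ = z * (z * (z * (z * z)))

        P : Carrier → Carrier → Carrier
        P x y = 1# + x * (m + x * (b 2 + x * (b 3 + x * (b 4 + x * (b 5 + x * y)))))

        P₊ : P v (tail 6 n v) ≈ (1# + z) ^ n
        P₊ = trans (sym (expand v)) (^-congˡ n (+-congˡ (*-identityˡ z)))

        P₋ : P w (tail 6 n w) ≈ (1# - z) ^ n
        P₋ = trans (sym (expand w)) (^-congˡ n (+-congˡ (-1*x≈-x z)))

        zⁿ : z * z⁵ * Y z ≈ δ * z ^ n
        zⁿ = trans
          (solve 3 (λ z δ y → z :* (z :* (z :* (z :* (z :* z)))) :* (δ :* y) :=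
                              δ :* (z :* (z :* (z :* (z :* (z :* (z :* y)))))))
             refl z δ (z ^ r))
          (*-congˡ (reflexive (≡.cong (z ^_) (≡.sym n≡6+r))))

        zᵗ : m * z * (1# - z⁵ * Y z) ≈ m * z * (1# - δ * z ^ t)
        zᵗ = *-congˡ (+-congˡ (-‿cong (trans
          (solve 3 (λ z δ y → z :* (z :* (z :* (z :* z))) :* (δ :* y) :=
                              δ :* (z :* (z :* (z :* (z :* (z :* y))))))
             refl z δ (z ^ r))
          (*-congˡ (reflexive (≡.cong (z ^_) (≡.sym t≡5+r)))))))

      -- Since 5 + D = 2 t, degrees up to 4 + D stay below the number of points.
      2t>degree : ∀ k → k ℕ.≤ 4 → k ℕ.+ D ℕ.< length zs
      2t>degree k k≤4 = ℕ.≤-trans (ℕ.≤-trans (ℕ.s≤s (ℕ.+-monoˡ-≤ D k≤4)) (ℕ.≤-reflexive 5+D≡2t)) 2t≤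
        where
        5+D≡2t : 5 ℕ.+ D ≡ t ℕ.+ t
        5+D≡2t = ≡.trans
          (≡.cong (5 ℕ.+_) (≡.trans (≡.cong (ℕ._+ r) (ℕ.+-comm 5 r)) (ℕ.+-assoc r 5 r)))
          (≡.sym (≡.cong₂ ℕ._+_ t≡5+r t≡5+r))

      nonzero-roots : ∀ {f k} → k ℕ.≤ 4 → Degree≤ (k ℕ.+ D) f → (∀ z → ¬ z ≈ 0# → f z ≈ 0#) → f 0# ≈ 0#
      nonzero-roots k≤4 (_ , _ , p) f≈0 =
        proj₂ (roots>degree cancel p zs! (All.map (f≈0 _) zs≉0) (2t>degree _ k≤4)) 0#

      e₂≈0 : e₂ ≈ 0#
      e₂≈0 = trans (solve 2 (λ e y → e := e :+ con (+ 0) :* y) refl e₂ _)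
        (nonzero-roots (ℕ.m≤m+n 3 1) (k+x* k+x* k+x* Q≤) vanishing)

      -- Once `e₂` is zero, two more factors z cancel and the same count applies.
      e₄≈0 : e₄ ≈ 0#
      e₄≈0 = trans (solve 2 (λ e y → e := e :+ con (+ 0) :* y) refl e₄ (Q 0#))
        (nonzero-roots {k = 1} (ℕ.s≤s ℕ.z≤n) (k+x* Q≤) λ z z≉0 → cancel z≉0 (cancel z≉0 (begin
          z * (z * (e₄ + z * Q z))              ≈⟨ *-congˡ (+-identityˡ _) ⟨
          z * (0# + z * (e₄ + z * Q z))         ≈⟨ +-identityˡ _ ⟨
          0# + z * (0# + z * (e₄ + z * Q z))    ≈⟨ +-congʳ e₂≈0 ⟨
          e₂ + z * (0# + z * (e₄ + z * Q z))    ≈⟨ vanishing z z≉0 ⟩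
          0#                                    ∎)))

-- Listing finite subsets, and the p-part of a number.

members : ∀ {n} → Subset n → List (Fin n)
members []            = []
members (inside  ∷ p) = zero ∷ map suc (members p)
members (outside ∷ p) = map suc (members p)

length-members : ∀ {n} (p : Subset n) → length (members p) ≡ ∣ p ∣
length-members []            = ≡.refl
length-members (inside  ∷ p) = ≡.cong suc (≡.trans (length-map suc (members p)) (length-members p))
length-members (outside ∷ p) = ≡.trans (length-map suc (members p)) (length-members p)

members-∈ : ∀ {n} (p : Subset n) → All (Subset._∈ p) (members p)
members-∈ []            = []
members-∈ (inside  ∷ p) = here ∷ All.map⁺ (All.map there (members-∈ p))
members-∈ (outside ∷ p) = All.map⁺ (All.map there (members-∈ p))

members-complete : ∀ {n} {p : Subset n} {i} → i Subset.∈ p → Any (i ≡_) (members p)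
members-complete {p = inside  ∷ p} here        = here ≡.refl
members-complete {p = inside  ∷ p} (there i∈p) = there (Any.map⁺ (Any.map (≡.cong suc) (members-complete i∈p)))
members-complete {p = outside ∷ p} (there i∈p) = Any.map⁺ (Any.map (≡.cong suc) (members-complete i∈p))

members-unique : ∀ {n} (p : Subset n) → Unique (members p)
members-unique []            = []
members-unique (inside  ∷ p) =
  All.map⁺ (All.universal (λ _ ()) (members p)) ∷ Unique.map⁺ (λ { ≡.refl → ≡.refl }) (members-unique p)
members-unique (outside ∷ p) = Unique.map⁺ (λ { ≡.refl → ≡.refl }) (members-unique p)

p-part : ∀ {p} → 2 ℕ.≤ p → ∀ n → 1 ℕ.≤ n → ∃₂ λ e m → n ≡ m ℕ.* p ℕ.^ e × p ∤ m
p-part {p} 2≤p n = go n (<-wellFounded n)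
  where
  go : ∀ n → Acc ℕ._<_ n → 1 ℕ.≤ n → ∃₂ λ e m → n ≡ m ℕ.* p ℕ.^ e × p ∤ m
  go n (acc rec) 1≤n with p ∣? n
  ... | no p∤n = 0 , n , ≡.sym (ℕ.*-identityʳ n) , p∤n
  go .0 (acc rec) () | yes (divides zero ≡.refl)
  ... | yes (divides m@(suc _) ≡.refl) with go m (rec (ℕ.m<m*n m p 2≤p)) (ℕ.s≤s ℕ.z≤n)
  ... | e , m′ , eq , p∤m′ = suc e , m′ ,
    ≡.trans (≡.cong (ℕ._* p) eq) (≡.trans (ℕ.*-assoc m′ _ p) (≡.cong (m′ ℕ.*_) (ℕ.*-comm _ p))) , p∤m′

-- Finite fields: cancellation, lists of elements, orders in a subgroup.

module FiniteFieldProperties {c ℓ q} (F : FiniteField c ℓ q) where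
  open FiniteField F hiding (zero)
  open FieldSubsets F
  open RingProperties ring using () renaming (x∙y⁻¹≈ε⇒x≈y to x-y≈0⇒x≈y; x≈y⇒x∙y⁻¹≈ε to x≈y⇒x-y≈0)
  open IntegerCoefficients commutativeRing using
      (ι; 1+×; ×1-homo-*; solve; con; _:+_; _:*_; _:-_; :-_; _:=_)
  open PolynomialFunctions commutativeRing
  open PowerSums commutativeRing
  open Exp commutativeSemiring using (^-distrib-*; ^-assocʳ)
  open UniqueSetoid setoid using () renaming (Unique to Distinct)
  open SetoidReasoning setoid

  cancel : ∀ {x y} → ¬ x ≈ 0# → x * y ≈ 0# → y ≈ 0#
  cancel {x} {y} x≉0 xy≈0 with inverses x x≉0
  ... | x⁻¹ , xx⁻¹≈1 = begin
    y              ≈⟨ *-identityˡ y ⟨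
    1# * y         ≈⟨ *-congʳ xx⁻¹≈1 ⟨
    x * x⁻¹ * y    ≈⟨ solve 3 (λ x z y → x :* z :* y := z :* (x :* y)) refl x x⁻¹ y ⟩
    x⁻¹ * (x * y)  ≈⟨ *-congˡ xy≈0 ⟩
    x⁻¹ * 0#       ≈⟨ zeroʳ x⁻¹ ⟩
    0#             ∎

  *-nonzero : ∀ {x y} → ¬ x ≈ 0# → ¬ y ≈ 0# → ¬ x * y ≈ 0#
  *-nonzero x≉0 y≉0 xy≈0 = y≉0 (cancel x≉0 xy≈0)

  ^-nonzero : ∀ {x} n → ¬ x ≈ 0# → ¬ x ^ n ≈ 0#
  ^-nonzero zero    x≉0 = 1≉0
  ^-nonzero (suc n) x≉0 = *-nonzero x≉0 (^-nonzero n x≉0)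

  ^-zero⁻¹ : ∀ {x} n → x ^ n ≈ 0# → x ≈ 0#
  ^-zero⁻¹ {x} n xⁿ≈0 with x ≈? 0#
  ... | yes x≈0 = x≈0
  ... | no  x≉0 = ⊥-elim (^-nonzero n x≉0 xⁿ≈0)

  1^ : ∀ n → 1# ^ n ≈ 1#
  1^ zero    = refl
  1^ (suc n) = trans (*-identityˡ _) (1^ n)

  0^suc : ∀ n → 0# ^ suc n ≈ 0#
  0^suc n = zeroˡ _

  infix 4 _∈ₗ_
  _∈ₗ_ : Carrier → List Carrier → Set (c ⊔ ℓ)
  x ∈ₗ xs = Any (x ≈_) xs

  elements : Subset q → List Carrier
  elements S = map element (members S)

  length-elements : ∀ S → length (elements S) ≡ ∣ S ∣
  length-elements S = ≡.trans (length-map element (members S)) (length-members S)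

  elements-∈ : ∀ S → All (_∈ S) (elements S)
  elements-∈ S = All.map⁺ (All.map (λ {i} → ≡.subst (Subset._∈ S) (≡.sym (index-element i))) (members-∈ S))

  elements-complete : ∀ {S x} → x ∈ S → x ∈ₗ elements S
  elements-complete {x = x} x∈S = Any.map⁺ (Any.map
    (λ eq → trans (sym (element-index x)) (reflexive (≡.cong element eq))) (members-complete x∈S))

  element-injective : ∀ {i j} → element i ≈ element j → i ≡ j
  element-injective {i} {j} eq =
    ≡.trans (≡.sym (index-element i)) (≡.trans (Inverse.to-cong enumeration eq) (index-element j))

  elements-distinct : ∀ S → Distinct (elements S)
  elements-distinct S = DistinctProperties.map⁺ (≡.setoid (Fin q)) setoid element-injective (members-unique S)

  ∈ₗ⇒∈ : ∀ S {x} → x ∈ₗ elements S → x ∈ S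
  ∈ₗ⇒∈ S x∈ = All.lookupWith (λ y∈S x≈y → ∈-resp S (sym x≈y) y∈S) (elements-∈ S) x∈

  rootProduct-zero⁻¹ : ∀ {xs x} → rootProduct xs x ≈ 0# → ¬ All (λ y → ¬ x ≈ y) xs
  rootProduct-zero⁻¹ p []           = 1≉0 p
  rootProduct-zero⁻¹ p (x≉y ∷ x∉ys) =
    rootProduct-zero⁻¹ (cancel (λ x-y≈0 → x≉y (x-y≈0⇒x≈y _ _ x-y≈0)) p) x∉ys

  -- Π (a x - b) and aᵗ Π (x - b), with b running through the subgroup, have
  -- the same t roots; compare them at x = 0.
  order-power : ∀ {as} → Distinct as → All IsUnit as →
    (∀ {a b} → a ∈ₗ as → b ∈ₗ as → a * b ∈ₗ as) → ∀ {a} → a ∈ₗ as → a ^ length as ≈ 1#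
  order-power {as} as! units closed {a} a∈as = x-y≈0⇒x≈y _ _ (cancel h≉0 (begin
    h * (a ^ t - 1#)    ≈⟨ solve 2 (λ h p → h :* (p :- con (+ 1)) := p :* h :- h) refl h (a ^ t) ⟩
    a ^ t * h - h
      ≈⟨ x≈y⇒x-y≈0 (trans (sym (factorisation cancel (proj₂
          (rootProduct-affine as a 0#)) as! roots ≡.refl 0#))
                             (rootProduct-cong as (trans (+-identityʳ _) (zeroʳ a)))) ⟩
    0#                  ∎))
    where
    t = length as
    h = rootProduct as 0#
    h≉0 : ¬ h ≈ 0#
    h≉0 h≈0 = rootProduct-zero⁻¹ h≈0 (All.map (λ b≉0 0≈b → b≉0 (sym 0≈b)) units)
    roots : All (λ x → rootProduct as (a * x + 0#) ≈ 0#) as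
    roots = All.tabulateₛ setoid λ b∈as →
      rootProduct-root (Any.map (trans (+-identityʳ _)) (closed a∈as b∈as))

  -- Adding 1 permutes the field, so the sum `s` of all elements satisfies s + q = s.
  ι-q : ι q ≈ 0#
  ι-q = begin
    ι q                   ≈⟨ solve 2 (λ s x → x := (s :+ x) :- s) refl s (ι q) ⟩
    (s + ι q) - s         ≈⟨ +-congʳ (begin
      s + ι q
        ≈⟨ +-congˡ (trans (∑.sum-replicate q) (MonoidMultiples.×ᵤ≈× +-monoid q 1#)) ⟨
      s + ∑.sum {q} (λ _ → 1#)           ≈⟨ ∑.∑-distrib-+ element (λ _ → 1#) ⟨
      ∑.sum (λ i → element i + 1#)       ≈⟨ ∑.sum-cong-≋ (λ i → element-index (element i + 1#)) ⟨
      ∑.sum (λ i → element (shift i))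
        ≈⟨ ∑.sum-permute element (permutation shift unshift shift-unshift unshift-shift) ⟨
      s                                  ∎) ⟩
    s - s                 ≈⟨ -‿inverseʳ s ⟩
    0#                    ∎
    where
    module ∑ = Sum +-commutativeMonoid
    s = ∑.sum element
    shift unshift : Fin q → Fin q
    shift i = index (element i + 1#)
    unshift i = index (element i - 1#)
    shift-unshift : ∀ i → shift (unshift i) ≡ i
    shift-unshift i = element-injective (trans (element-index _) (trans (+-congʳ (element-index _))
      (solve 1 (λ x → x :- con (+ 1) :+ con (+ 1) := x) refl (element i))))
    unshift-shift : ∀ i → unshift (shift i) ≡ i
    unshift-shift i = element-injective (trans (element-index _) (trans (+-congʳ (element-index _))
      (solve 1 (λ x → x :+ con (+ 1) :- con (+ 1) := x) refl (element i))))

  ι-^ : ∀ p f → ι (p ℕ.^ f) ≈ ι p ^ f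
  ι-^ p zero    = refl
  ι-^ p (suc f) = trans (×1-homo-* p (p ℕ.^ f)) (*-congˡ (ι-^ p f))

  -- Characteristic p and the Frobenius map.

  module Characteristic {p} (p-prime : Prime p) (ιp≈0 : ι p ≈ 0#) where

    private
      bézout-zero : ∀ x y {a b} → ι a ≈ 0# → ι b ≈ 0# → 1 ℕ.+ y ℕ.* b ≡ x ℕ.* a → 1# ≈ 0#
      bézout-zero x y {a} {b} a≈0 b≈0 eq = begin
        1#                     ≈⟨ trans (+-congˡ (trans (*-congˡ b≈0) (zeroʳ (ι y)))) (+-identityʳ 1#) ⟨
        1# + ι y * ι b         ≈⟨ +-congˡ (×1-homo-* y b) ⟨
        1# + ι (y ℕ.* b)       ≈⟨ 1+× (y ℕ.* b) 1# ⟨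
        ι (1 ℕ.+ y ℕ.* b)      ≡⟨ ≡.cong ι eq ⟩
        ι (x ℕ.* a)            ≈⟨ ×1-homo-* x a ⟩
        ι x * ι a              ≈⟨ trans (*-congˡ a≈0) (zeroʳ (ι x)) ⟩
        0#                     ∎

    ι-nonzero : ∀ {m} → p ∤ m → ¬ ι m ≈ 0#
    ι-nonzero {m} p∤m ιm≈0 with coprime-Bézout coprime
      where
      coprime : Coprime p m
      coprime (d∣p , d∣m) with prime⇒irreducible p-prime d∣p
      ... | inj₁ d≡1    = d≡1
      ... | inj₂ ≡.refl = ⊥-elim (p∤m d∣m)
    ... | Bézout.+- x y eq = 1≉0 (bézout-zero x y ιp≈0 ιm≈0 eq)
    ... | Bézout.-+ x y eq = 1≉0 (bézout-zero y x ιm≈0 ιp≈0 eq)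

    1<p : 1 ℕ.< p
    1<p = ℕ.nonTrivial⇒n>1 p ⦃ prime⇒nonTrivial p-prime ⦄

    -- Induction along the absorption identity, whose right side vanishes for n = p. At `i = 0` the
    -- preceding coefficient is 1, but its factor `ι i` is zero.
    binomial-p : ∀ i → suc i ℕ.< p → binomial p (suc i) ≈ 0#
    binomial-p i i<p = cancel (ι-nonzero (λ p∣i → ℕ.<⇒≱ i<p (∣⇒≤ p∣i))) (begin
      ι (suc i) * binomial p (suc i)                       ≈⟨ trans (+-congˡ (previous i i<p)) (+-identityʳ _) ⟨
      ι (suc i) * binomial p (suc i) + ι i * binomial p i  ≈⟨ binomial-absorption p i ⟩
      ι p * binomial p i                                       ≈⟨ trans (*-congʳ ιp≈0) (zeroˡ _) ⟩
      0#                                                       ∎)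
      where
      previous : ∀ i → suc i ℕ.< p → ι i * binomial p i ≈ 0#
      previous zero    _   = zeroˡ _
      previous (suc i) i<p = trans (*-congˡ (binomial-p i (ℕ.≤-trans (ℕ.n≤1+n _) i<p))) (zeroʳ _)

    tail-p : ∀ j i x → j ℕ.+ suc i ≡ p → tail (suc i) p x ≈ x ^ j
    tail-p zero i x ≡.refl = trans (tail-unfold p p x) (trans
      (+-cong (binomial-diagonal p) (trans (*-congˡ (tail-vanishes x (ℕ.n<1+n p))) (zeroʳ x))) (+-identityʳ 1#))
    tail-p (suc j) i x eq = begin
      tail (suc i) p x                                       ≈⟨ tail-unfold (suc i) p x ⟩
      binomial p (suc i) + x * tail (suc (suc i)) p x
        ≈⟨ +-cong (binomial-p i i<p) (*-congˡ (tail-p j (suc i) x (≡.trans (ℕ.+-suc j (suc i)) eq))) ⟩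
      0# + x * x ^ j                                           ≈⟨ +-identityˡ _ ⟩
      x ^ suc j                                              ∎
      where
      i<p : suc i ℕ.< p
      i<p = ≡.subst (suc i ℕ.<_) eq (ℕ.s≤s (ℕ.m≤n+m (suc i) j))

    1+-^p : ∀ x → (1# + x) ^ p ≈ 1# + x ^ p
    1+-^p x = go p ≡.refl
      where
      go : ∀ n → n ≡ p → (1# + x) ^ p ≈ 1# + x ^ p
      go zero    0≡p = ⊥-elim (ℕ.n≮0 (≡.subst (1 ℕ.<_) (≡.sym 0≡p) 1<p))
      go (suc n) n≡p = trans (tail-unfold 0 p x) (+-congˡ (trans
        (*-congˡ (tail-p n 0 x (≡.trans (ℕ.+-comm n 1) n≡p))) (reflexive (≡.cong (x ^_) n≡p))))

    -- The expansion by `tail` treats only 1 + x; by homogeneity it is applied to 1 + y / x, which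
    -- leaves x = 0 as a separate case.
    frobenius : ∀ x y → (x + y) ^ p ≈ x ^ p + y ^ p
    frobenius x y with x ≈? 0#
    ... | yes x≈0 = begin
      (x + y) ^ p        ≈⟨ ^-congˡ p (trans (+-congʳ x≈0) (+-identityˡ y)) ⟩
      y ^ p              ≈⟨ +-identityˡ _ ⟨
      0# + y ^ p         ≈⟨ +-congʳ (trans (^-congˡ p x≈0) (0^p p 1<p)) ⟨
      x ^ p + y ^ p      ∎
      where
      0^p : ∀ n → 1 ℕ.< n → 0# ^ n ≈ 0#
      0^p (suc n) _ = 0^suc n
    ... | no x≉0 with inverses x x≉0
    ... | z , xz≈1 = begin
      (x + y) ^ p                  ≈⟨ ^-congˡ p (+-cong (*-identityʳ x) xzy≈y) ⟨
      (x * 1# + x * (z * y)) ^ p   ≈⟨ ^-congˡ p (distribˡ x 1# (z * y)) ⟨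
      (x * (1# + z * y)) ^ p       ≈⟨ ^-distrib-* x _ p ⟩
      x ^ p * (1# + z * y) ^ p     ≈⟨ *-congˡ (1+-^p (z * y)) ⟩
      x ^ p * (1# + (z * y) ^ p)   ≈⟨ distribˡ _ _ _ ⟩
      x ^ p * 1# + x ^ p * (z * y) ^ p  ≈⟨ +-cong (*-identityʳ _) (sym (^-distrib-* x (z * y) p)) ⟩
      x ^ p + (x * (z * y)) ^ p    ≈⟨ +-congˡ (^-congˡ p xzy≈y) ⟩
      x ^ p + y ^ p                ∎
      where
      xzy≈y : x * (z * y) ≈ y
      xzy≈y = trans (sym (*-assoc x z y)) (trans (*-congʳ xz≈1) (*-identityˡ y))

    frobenius^ : ∀ e x y → (x + y) ^ (p ℕ.^ e) ≈ x ^ (p ℕ.^ e) + y ^ (p ℕ.^ e)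
    frobenius^ zero    x y = trans (*-identityʳ _) (sym (+-cong (*-identityʳ x) (*-identityʳ y)))
    frobenius^ (suc e) x y = begin
      (x + y) ^ (p ℕ.* p ℕ.^ e)                          ≈⟨ ^-assocʳ (x + y) p (p ℕ.^ e) ⟨
      ((x + y) ^ p) ^ (p ℕ.^ e)                          ≈⟨ ^-congˡ (p ℕ.^ e) (frobenius x y) ⟩
      (x ^ p + y ^ p) ^ (p ℕ.^ e)                        ≈⟨ frobenius^ e (x ^ p) (y ^ p) ⟩
      (x ^ p) ^ (p ℕ.^ e) + (y ^ p) ^ (p ℕ.^ e)
        ≈⟨ +-cong (^-assocʳ x p (p ℕ.^ e)) (^-assocʳ y p (p ℕ.^ e)) ⟩
      x ^ (p ℕ.* p ℕ.^ e) + y ^ (p ℕ.* p ℕ.^ e)          ∎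

-- The subgroup of k-th powers and its decompositions as a sumset.

module PowerSubgroup {c ℓ q} (F : FiniteField c ℓ q) where
  open FiniteField F hiding (zero)
  open FieldSubsets F hiding (add; mul)
  open FiniteFieldProperties F
  open RingProperties ring using () renaming (x∙y⁻¹≈ε⇒x≈y to x-y≈0⇒x≈y; x≈y⇒x∙y⁻¹≈ε to x≈y⇒x-y≈0)
  open IntegerCoefficients commutativeRing
    using (ι; ×-homo-+; solve; con; _:+_; _:*_; _:-_; :-_; _:=_)
  open PolynomialFunctions commutativeRing
  open PowerSums commutativeRing
  open Exp commutativeSemiring using (^-distrib-*; ^-assocʳ)
  open UniqueSetoid setoid using () renaming (Unique to Distinct)
  open SetoidReasoning setoid

  module SumsetDecompositions {p} (p-prime : Prime p) (ιp≈0 : ι p ≈ 0#) (k r : ℕ)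
    (∣A∣≡5+r : ∣ powers k ∣ ≡ 5 ℕ.+ r) (generates : ∀ x → 𝔽ₚ⟨ powers k ⟩ x)
    {g : Carrier} (g≉0 : ¬ g ≈ 0#) (g∉A : ¬ g ∈ powers k) where

    open Characteristic p-prime ιp≈0

    A : Subset q
    A = powers k

    as : List Carrier
    as = elements A

    t′ t n : ℕ
    t′ = 4 ℕ.+ r
    t = suc t′
    n = suc t

    length-as : length as ≡ t
    length-as = ≡.trans (length-elements A) ∣A∣≡5+r

    A-unit : ∀ {a} → a ∈ A → ¬ a ≈ 0#
    A-unit a∈A a≈0 with Equivalence.to (∈-powers k _) a∈A
    ... | x , x≉0 , a≈xᵏ = ^-nonzero k x≉0 (trans (sym a≈xᵏ) a≈0)

    A-closed : ∀ {a b} → a ∈ A → b ∈ A → a * b ∈ A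
    A-closed a∈A b∈A with Equivalence.to (∈-powers k _) a∈A | Equivalence.to (∈-powers k _) b∈A
    ... | x , x≉0 , a≈xᵏ | y , y≉0 , b≈yᵏ = Equivalence.from (∈-powers k _)
      (x * y , *-nonzero x≉0 y≉0 , trans (*-cong a≈xᵏ b≈yᵏ) (sym (^-distrib-* x y k)))

    A-distinct : Distinct as
    A-distinct = elements-distinct A

    A-unity : ∀ {a} → a ∈ A → a ^ t ≈ 1#
    A-unity {a} a∈A = ≡.subst (λ t → a ^ t ≈ 1#) length-as
      (order-power A-distinct (All.map A-unit (elements-∈ A))
        (λ a∈ b∈ → elements-complete (A-closed (∈ₗ⇒∈ A a∈) (∈ₗ⇒∈ A b∈))) (elements-complete a∈A))

    unity-polynomial : Polynomial t 1# (λ x → x ^ t - 1#) (λ x → ι t * (x + 0#) ^ t′)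
    unity-polynomial = polynomial-resp refl (λ x → +-congʳ (^-congˡ t (sym (+-identityʳ x)))) (λ _ → refl)
      (add-constant (- 1#) (power t 0#))

    A-roots : All (λ a → a ^ t - 1# ≈ 0#) as
    A-roots = All.map (λ a∈A → x≈y⇒x-y≈0 (A-unity a∈A)) (elements-∈ A)

    -- A already supplies `t` roots of xᵗ - 1, so a root outside A would exceed the degree.
    unity-A : ∀ {x} → x ^ t ≈ 1# → x ∈ A
    unity-A {x} xᵗ≈1 with x ∈? A
    ... | yes x∈A = x∈A
    ... | no  x∉A = ⊥-elim (ℕ.<-irrefl ≡.refl (≡.subst (λ m → suc m ℕ.≤ t) length-as
      (roots≤degree cancel unity-polynomial 1≉0 (All.¬Any⇒All¬ as (λ x∈as → x∉A (∈ₗ⇒∈ A x∈as)) ∷ A-distinct)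
        (x≈y⇒x-y≈0 xᵗ≈1 ∷ A-roots))))

    -- Otherwise the derivative of xᵗ - 1 would vanish identically, and all `t` elements of A would
    -- be double roots of a polynomial of degree `t`.
    ιt≉0 : ¬ ι t ≈ 0#
    ιt≉0 ιt≈0 = ℕ.m+1+n≰m t (≡.subst (λ m → m ℕ.+ m ℕ.≤ t) length-as
      (doubleRoots≤degree cancel unity-polynomial 1≉0 A-distinct
        (All.map (λ root → root , trans (*-congʳ ιt≈0) (zeroˡ _)) A-roots)))

    Unity : List (Carrier × Carrier) → Carrier → Set _
    Unity ps s = All (λ (c , u) → (s + u) ^ t ≈ 1#) ps

    powerSum-doubleRoot : ∀ ps {s} → moment ps 0 ≈ 0# → Unity ps s →
      DoubleRoot cancel (λ x → powerSum ps n x - moment ps 1) (λ x → ι n * powerSum ps t x) s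
    powerSum-doubleRoot ps {s} m₀≈0 unity =
      x≈y⇒x-y≈0 (trans (powerSum-suc-unity unity)
          (trans (+-congʳ (trans (*-congˡ m₀≈0) (zeroʳ s))) (+-identityˡ _))) ,
      trans (*-congˡ (trans (powerSum-unity unity) m₀≈0)) (zeroʳ _)

    module Pair {u₁ u₂} (u₁≉u₂ : ¬ u₁ ≈ u₂) {ss} (ss! : Distinct ss)
      (unity : All (λ s → (s + u₁) ^ t ≈ 1# × (s + u₂) ^ t ≈ 1#) ss) where

      -- The map `φ` is the identity for the bound by double roots, and the P-th power map when p ∣
      -- n.
      ps : (Carrier → Carrier) → List (Carrier × Carrier)
      ps φ = (1# , φ u₁) ∷ (- 1# , φ u₂) ∷ []

      m₀≈0 : 1# * 1# + (- 1# * 1# + 0#) ≈ 0#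
      m₀≈0 = solve 0 (con (+ 1) :* con (+ 1) :+ (:- con (+ 1) :* con (+ 1) :+ con (+ 0)) := con (+ 0)) refl

      moment₁ : ∀ φ → moment (ps φ) 1 ≈ φ u₁ - φ u₂
      moment₁ φ = solve 2 (λ u v → con (+ 1) :* (u :* con (+ 1))
          :+ (:- con (+ 1) :* (v :* con (+ 1)) :+ con (+ 0)) := u :- v)
        refl (φ u₁) (φ u₂)

      polynomial : Polynomial t (ι n * moment (ps id) 1) (λ x → powerSum (ps id) n x - moment (ps id) 1)
                                (λ x → ι n * powerSum (ps id) t x)
      polynomial = add-constant (- moment (ps id) 1) (powerSum-degree₁ (ps id) t m₀≈0)

      doubleRoots : All (DoubleRoot cancel (λ x → powerSum (ps id) n x - moment (ps id) 1)
                                           (λ x → ι n * powerSum (ps id) t x)) ss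
      doubleRoots = All.map (λ (p₁ , p₂) → powerSum-doubleRoot (ps id) m₀≈0 (p₁ ∷ p₂ ∷ [])) unity

      moment₁≉0 : ¬ moment (ps id) 1 ≈ 0#
      moment₁≉0 m₁≈0 = u₁≉u₂ (x-y≈0⇒x≈y _ _ (trans (sym (moment₁ id)) m₁≈0))

      at-most-half : ¬ ι n ≈ 0# → length ss ℕ.+ length ss ℕ.≤ t
      at-most-half n≉0 = doubleRoots≤degree cancel polynomial (*-nonzero n≉0 moment₁≉0) ss! doubleRoots

      -- If p ∣ n, say n = m P with P a power of p, then the polynomial above is
      -- one of degree m - 1 in x ^ P; and m = 1 would make A ∪ {0} a subfield.
      less-than-half : ι n ≈ 0# → length ss ℕ.+ length ss ℕ.< t
      less-than-half n≈0 with p-part 1<p n (ℕ.s≤s ℕ.z≤n)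
      ... | e , 0 , _ , p∤0 = ⊥-elim (p∤0 (p ∣0))
      -- The fixed points of the P-th power map form a subfield; it contains A, hence everything.
      -- Thus gⁿ = g, so gᵗ = 1 and g lies in A.
      ... | e , 1 , n≡P , _ = ⊥-elim (g∉A (unity-A (x-y≈0⇒x≈y _ _ (cancel g≉0 (begin
        g * (g ^ t - 1#)    ≈⟨ solve 2 (λ g h → g :* (h :- con (+ 1)) := g :* h :- g) refl g (g ^ t) ⟩
        g ^ n - g           ≈⟨ x≈y⇒x-y≈0 (trans (reflexive (≡.cong (g ^_) n≡1*P)) (everything g)) ⟩
        0#                  ∎)))))
        where
        P = p ℕ.^ e
        n≡1*P : n ≡ P
        n≡1*P = ≡.trans n≡P (ℕ.*-identityˡ P)
        0^P : 0# ^ P ≈ 0#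
        0^P = trans (reflexive (≡.cong (0# ^_) (≡.sym n≡1*P))) (zeroˡ _)
        fixed : IsSubfield (λ x → x ^ P ≈ x)
        fixed = record
          { resp = λ x≈y xᴾ≈x → trans (^-congˡ P (sym x≈y)) (trans xᴾ≈x x≈y)
          ; 0-closed = 0^P
          ; 1-closed = 1^ P
          ; +-closed = λ xᴾ yᴾ → trans (frobenius^ e _ _) (+-cong xᴾ yᴾ)
          ; neg-closed = λ {x} xᴾ → begin
              (- x) ^ P                  ≈⟨ solve 2 (λ x y → y := (:- x) :+ (x :+ y)) refl x ((- x) ^ P) ⟩
              - x + (x + (- x) ^ P)      ≈⟨ +-congˡ (+-congʳ xᴾ) ⟨
              - x + (x ^ P + (- x) ^ P)  ≈⟨ +-congˡ (frobenius^ e x (- x)) ⟨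
              - x + (x - x) ^ P          ≈⟨ +-congˡ (trans (^-congˡ P (-‿inverseʳ x)) 0^P) ⟩
              - x + 0#                   ≈⟨ +-identityʳ _ ⟩
              - x                        ∎
          ; *-closed = λ xᴾ yᴾ → trans (^-distrib-* _ _ P) (*-cong xᴾ yᴾ)
          ; inv-closed = λ {x} {y} xy≈1 xᴾ → begin
              y ^ P                ≈⟨ *-identityˡ _ ⟨
              1# * y ^ P           ≈⟨ *-congʳ xy≈1 ⟨
              x * y * y ^ P        ≈⟨ solve 3 (λ x y z → x :* y :* z := y :* (x :* z)) refl x y (y ^ P) ⟩
              y * (x * y ^ P)      ≈⟨ *-congˡ (*-congʳ xᴾ) ⟨
              y * (x ^ P * y ^ P)  ≈⟨ *-congˡ (^-distrib-* x y P) ⟨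
              y * (x * y) ^ P      ≈⟨ *-congˡ (trans (^-congˡ P xy≈1) (1^ P)) ⟩
              y * 1#               ≈⟨ *-identityʳ y ⟩
              y                    ∎
          }
        everything : ∀ x → x ^ P ≈ x
        everything x = 𝔽ₚ⟨⟩-least fixed
          (λ {a} a∈A → trans (reflexive (≡.cong (a ^_) (≡.sym n≡1*P)))
              (trans (*-congˡ (A-unity a∈A)) (*-identityʳ a)))
          (generates x)
      ... | 0 , m@(suc (suc _)) , n≡m*1 , p∤m =
        ⊥-elim (ι-nonzero p∤m (trans (reflexive (≡.cong ι (≡.sym (≡.trans n≡m*1 (ℕ.*-identityʳ m))))) n≈0))
      -- With |S| ≤ m - 1 this is 2 |S| + 2 ≤ 2 m ≤ m P = t + 1.
      ... | e@(suc e′) , m@(suc (suc m′)) , n≡m*P , p∤m = ℕ.s≤s⁻¹ (ℕ.≤-trans (ℕ.≤-trans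
          (ℕ.s≤s (ℕ.s≤s (ℕ.+-mono-≤ few few)))
          (ℕ.≤-reflexive 2m-eq))
          (ℕ.≤-trans (ℕ.*-monoʳ-≤ m 2≤P) (ℕ.≤-reflexive (≡.sym n≡m*P))))
        where
        P = p ℕ.^ e
        φ : Carrier → Carrier
        φ x = x ^ P
        2≤P : 2 ℕ.≤ P
        2≤P = ℕ.≤-trans 1<p (ℕ.m≤m*n p (p ℕ.^ e′) ⦃ ℕ.m^n≢0 p e′ ⦃ ℕ.>-nonZero (ℕ.<-trans (ℕ.s≤s ℕ.z≤n) 1<p) ⦄ ⦄)
        2m-eq : 2 ℕ.+ (suc m′ ℕ.+ suc m′) ≡ m ℕ.* 2
        2m-eq = ≡.trans (≡.cong (λ x → 3 ℕ.+ x) (ℕ.+-suc m′ m′))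
          (≡.trans (≡.cong (λ x → 4 ℕ.+ (m′ ℕ.+ x)) (≡.sym (ℕ.+-identityʳ m′))) (≡.cong (4 ℕ.+_) (ℕ.*-comm 2 m′)))
        φ-injective : ∀ {x y} → φ x ≈ φ y → x ≈ y
        φ-injective {x} {y} φx≈φy = x-y≈0⇒x≈y _ _ (^-zero⁻¹ P (begin
          φ (x - y)                 ≈⟨ solve 2 (λ a b → a := (a :+ b) :- b) refl (φ (x - y)) (φ y) ⟩
          φ (x - y) + φ y - φ y     ≈⟨ +-congʳ (frobenius^ e (x - y) y) ⟨
          φ (x - y + y) - φ y       ≈⟨ +-congʳ (^-congˡ P (solve 2 (λ x y → x :- y :+ y := x) refl x y)) ⟩
          φ x - φ y                 ≈⟨ x≈y⇒x-y≈0 φx≈φy ⟩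
          0#                        ∎))
        φ-power : ∀ s u → (s + u) ^ t ≈ 1# → (φ s + φ u) ^ m ≈ s + u
        φ-power s u eq = begin
          (φ s + φ u) ^ m      ≈⟨ ^-congˡ m (frobenius^ e s u) ⟨
          φ (s + u) ^ m        ≈⟨ ^-assocʳ (s + u) P m ⟩
          (s + u) ^ (P ℕ.* m)  ≡⟨ ≡.cong ((s + u) ^_) (≡.trans (ℕ.*-comm P m) (≡.sym n≡m*P)) ⟩
          (s + u) * (s + u) ^ t ≈⟨ *-congˡ eq ⟩
          (s + u) * 1#         ≈⟨ *-identityʳ _ ⟩
          s + u                ∎
        -- By `φ-power`, `φ s` is a root of (y + φ u₁)ᵐ - (y + φ u₂)ᵐ - (u₁ - u₂), whose leading
        -- coefficient m (φ u₁ - φ u₂) is nonzero since p ∤ m. As `φ` is injective, simple roots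
        -- suffice.
        few : length ss ℕ.≤ suc m′
        few = ≡.subst (ℕ._≤ suc m′) (length-map φ ss) (roots≤degree cancel
          (add-constant (- (u₁ - u₂)) (powerSum-degree₁ (ps φ) (suc m′) m₀≈0))
          (*-nonzero (ι-nonzero p∤m) (λ m₁≈0 → u₁≉u₂ (φ-injective (x-y≈0⇒x≈y _ _ (trans (sym (moment₁ φ)) m₁≈0)))))
          (DistinctProperties.map⁺ setoid setoid φ-injective ss!)
          (All.map⁺ (All.map (λ {s} (p₁ , p₂) → begin
              powerSum (ps φ) m (φ s) - (u₁ - u₂)
                ≈⟨ +-congʳ (+-cong (*-congˡ (φ-power s u₁ p₁)) (+-congʳ (*-congˡ (φ-power s u₂ p₂)))) ⟩
              1# * (s + u₁) + (- 1# * (s + u₂) + 0#) - (u₁ - u₂)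
                ≈⟨ solve 3 (λ s u v → con (+ 1) :* (s :+ u)
                    :+ (:- con (+ 1) :* (s :+ v) :+ con (+ 0)) :- (u :- v) := con (+ 0)) refl s u₁ u₂ ⟩
              0# ∎) unity)))

    -- Lists of distinct elements, so that two or three elements of a summand can be obtained by
    -- matching; symmetric in the two summands by `swap`.
    record Decomposition (ss us : List Carrier) : Set (c ⊔ ℓ) where
      field
        ss-distinct : Distinct ss
        us-distinct : Distinct us
        sums        : ∀ {s u} → s ∈ₗ ss → u ∈ₗ us → s + u ∈ A
        covers      : ∀ {a} → a ∈ A → ∃₂ λ s u → s ∈ₗ ss × u ∈ₗ us × a ≈ s + u

      unity : ∀ {u} → u ∈ₗ us → All (λ s → (s + u) ^ t ≈ 1#) ss
      unity u∈us = All.tabulateₛ setoid λ s∈ss → A-unity (sums s∈ss u∈us)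

    swap : ∀ {ss us} → Decomposition ss us → Decomposition us ss
    swap D = record
      { ss-distinct = us-distinct
      ; us-distinct = ss-distinct
      ; sums        = λ u∈us s∈ss → ∈-resp A (+-comm _ _) (sums s∈ss u∈us)
      ; covers      = λ a∈A → let s , u , s∈ss , u∈us , a≈s+u = covers a∈A in
                              u , s , u∈us , s∈ss , trans a≈s+u (+-comm s u)
      }
      where open Decomposition D

    module _ {ss u₁ u₂ u₃ us} (D : Decomposition ss (u₁ ∷ u₂ ∷ u₃ ∷ us)) (n≉0 : ¬ ι n ≈ 0#) where
      open Decomposition D

      -- With Σ c = Σ c u = 0, the degree of Σ c (x + u)ⁿ drops to t - 1.
      half-contradicts-three : ¬ length ss ℕ.+ length ss ≡ t
      half-contradicts-three 2∣S∣≡t with us-distinct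
      ... | (u₁≉u₂ ∷ u₁≉u₃ ∷ _) ∷ (u₂≉u₃ ∷ _) ∷ _ =
        ℕ.<-irrefl ≡.refl (≡.subst (ℕ._≤ t′) 2∣S∣≡t (doubleRoots≤degree cancel
          (powerSum-degree₂ ps t′ m₀≈0 m₁≈0) lead≉0 ss-distinct
          (All.zipWith (λ (p₁ , p₂ , p₃) → double-root (p₁ ∷ p₂ ∷ p₃ ∷ []))
            (unity (here refl) , All.zip (unity (there (here refl)) , unity (there (there (here refl))))))))
        where
        -- The weights of the second divided difference at u₁, u₂, u₃, cleared of denominators: they
        -- annihilate constants and linear functions, and the second moment is the Vandermonde
        -- product.
        ps : List (Carrier × Carrier)
        ps = (u₂ - u₃ , u₁) ∷ (u₃ - u₁ , u₂) ∷ (u₁ - u₂ , u₃) ∷ []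
        m₀≈0 : moment ps 0 ≈ 0#
        m₀≈0 = solve 3 (λ u v w → (v :- w) :* con (+ 1) :+ ((w :- u) :* con (+ 1)
            :+ ((u :- v) :* con (+ 1) :+ con (+ 0))) := con (+ 0))
          refl u₁ u₂ u₃
        m₁≈0 : moment ps 1 ≈ 0#
        m₁≈0 = solve 3 (λ u v w → (v :- w) :* (u :* con (+ 1)) :+ ((w :- u) :* (v :* con (+ 1))
            :+ ((u :- v) :* (w :* con (+ 1)) :+ con (+ 0))) := con (+ 0))
          refl u₁ u₂ u₃
        m₂ : moment ps 2 ≈ (u₁ - u₂) * ((u₁ - u₃) * (u₂ - u₃))
        m₂ = solve 3 (λ u v w → (v :- w) :* (u :* (u :* con (+ 1))) :+ ((w :- u) :* (v :* (v :* con (+ 1)))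
            :+ ((u :- v) :* (w :* (w :* con (+ 1))) :+ con (+ 0)))
          := (u :- v) :* ((u :- w) :* (v :- w))) refl u₁ u₂ u₃
        difference≉0 : ∀ {x y} → ¬ x ≈ y → ¬ x - y ≈ 0#
        difference≉0 x≉y x-y≈0 = x≉y (x-y≈0⇒x≈y _ _ x-y≈0)
        lead≉0 : ¬ triangular t′ * moment ps 2 ≈ 0#
        lead≉0 = *-nonzero
          (λ tri≈0 → *-nonzero ιt≉0 n≉0 (trans (sym (2*triangular t′)) (trans (*-congˡ tri≈0) (zeroʳ _))))
          (λ m₂≈0 → *-nonzero (difference≉0 u₁≉u₂) (*-nonzero (difference≉0 u₁≉u₃) (difference≉0 u₂≉u₃))
              (trans (sym m₂) m₂≈0))
        double-root : ∀ {s} → Unity ps s → DoubleRoot cancel (powerSum ps n) (λ x → ι n * powerSum ps t x) s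
        double-root unity with powerSum-doubleRoot ps m₀≈0 unity
        ... | p , p′ = trans (x-y≈0⇒x≈y _ _ p) m₁≈0 , p′

    translateProduct : List Carrier → (u₁ u₂ x : Carrier) → Carrier
    translateProduct ss u₁ u₂ x = rootProduct ss (x - u₁) * rootProduct ss (x - u₂)

    translateProduct-degree : ∀ ss u₁ u₂ → ∃ λ f′ →
      Polynomial (length ss ℕ.+ length ss) 1# (translateProduct ss u₁ u₂) f′
    translateProduct-degree ss u₁ u₂ = _ , polynomial-resp
      (trans (*-cong (1^ (length ss)) (1^ (length ss))) (*-identityˡ 1#))
      (λ x → *-cong (rootProduct-cong ss (+-congʳ (sym (*-identityˡ x)))) (rootProduct-cong ss
          (+-congʳ (sym (*-identityˡ x)))))
      (λ _ → refl)
      (mul (proj₂ (rootProduct-affine ss 1# (- u₁))) (proj₂ (rootProduct-affine ss 1# (- u₂))))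

    module _ {ss u₁ u₂} (D : Decomposition ss (u₁ ∷ u₂ ∷ [])) where
      open Decomposition D

      private
        h : Carrier → Carrier
        h = rootProduct ss

      translateProduct-roots : All (λ a → translateProduct ss u₁ u₂ a ≈ 0#) as
      translateProduct-roots = All.map (λ a∈A → root (covers a∈A)) (elements-∈ A)
        where
        difference : ∀ {s u v a} → u ≈ v → a ≈ s + u → a - v ≈ s
        difference {s} {u} {v} {a} u≈v a≈s+u = begin
          a - v      ≈⟨ +-cong a≈s+u (-‿cong (sym u≈v)) ⟩
          s + u - u  ≈⟨ solve 2 (λ s u → s :+ u :- u := s) refl s u ⟩
          s          ∎
        root : ∀ {a} → (∃₂ λ s u → s ∈ₗ ss × u ∈ₗ u₁ ∷ u₂ ∷ [] × a ≈ s + u) → translateProduct ss u₁ u₂ a ≈ 0#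
        root (s , u , s∈ss , here u≈u₁ , a≈s+u) = trans
          (*-congʳ (rootProduct-root (Any.map (trans (difference u≈u₁ a≈s+u)) s∈ss))) (zeroˡ _)
        root (s , u , s∈ss , there (here u≈u₂) , a≈s+u) = trans
          (*-congˡ (rootProduct-root (Any.map (trans (difference u≈u₂ a≈s+u)) s∈ss))) (zeroʳ _)

      -- A lies in the union of two translates of S. The count goes through the degree of
      -- `translateProduct`, which in the case of equality also factors xᵗ - 1.
      covered-by-two : t ℕ.≤ length ss ℕ.+ length ss
      covered-by-two = ≡.subst (ℕ._≤ length ss ℕ.+ length ss) length-as
        (roots≤degree cancel (proj₂ (translateProduct-degree ss u₁ u₂)) 1≉0 A-distinct translateProduct-roots)

      -- Taking `squares` at x - u₁ and at x - u₂ gives n d h(x - u₁)² and n d h(x - u₂)². Their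
      -- product is the square of n d (xᵗ - 1) by `product`, so `h` disappears and a relation in n,
      -- d and x alone remains.
      half-contradicts-two : ¬ ι n ≈ 0# → ¬ length ss ℕ.+ length ss ≡ t
      half-contradicts-two n≉0 2∣S∣≡t with us-distinct
      -- The points are the cosets A and gA, disjoint because (g b)ᵗ = gᵗ ≠ 1 for b in A.
      ... | (u₁≉u₂ ∷ []) ∷ _ = translates-contradiction cancel r δ ≡.refl ≡.refl 2≉0 ιt≉0 n≉0
        (DistinctProperties.++⁺ setoid A-distinct
            (DistinctProperties.map⁺ setoid setoid g*-injective A-distinct) disjoint)
        (All.++⁺ (All.map A-unit (elements-∈ A)) (All.map⁺ (All.map (λ a∈A → *-nonzero g≉0 (A-unit a∈A))
            (elements-∈ A))))
        (ℕ.≤-reflexive (≡.sym (≡.trans (length-++ as)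
            (≡.cong₂ ℕ._+_ length-as (≡.trans (length-map (g *_) as) length-as)))))
        identity
        where
        open TwoTranslates commutativeRing
        open Pair u₁≉u₂ ss-distinct (All.zip (unity (here refl) , unity (there (here refl))))

        2≉0 : ¬ ι 2 ≈ 0#
        2≉0 2≈0 = ιt≉0 (begin
          ι t                          ≡⟨ ≡.cong ι 2∣S∣≡t ⟨
          ι (length ss ℕ.+ length ss)  ≈⟨ ×-homo-+ 1# (length ss) (length ss) ⟩
          ι (length ss) + ι (length ss) ≈⟨ solve 1 (λ x → x :+ x := con (+ 2) :* x) refl (ι (length ss)) ⟩
          ι 2 * ι (length ss)          ≈⟨ trans (*-congʳ 2≈0) (zeroˡ _) ⟩
          0#                           ∎)

        g*-injective : ∀ {x y} → g * x ≈ g * y → x ≈ y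
        g*-injective {x} {y} gx≈gy = x-y≈0⇒x≈y _ _ (cancel g≉0 (trans
          (solve 3 (λ g x y → g :* (x :- y) := g :* x :- g :* y) refl g x y) (x≈y⇒x-y≈0 gx≈gy)))

        disjoint : ∀ {x} → ¬ (x ∈ₗ as × x ∈ₗ map (g *_) as)
        disjoint {x} (x∈as , x∈gas) = g∉A (unity-A
          (All.lookupWith (λ b∈A x≈gb → gᵗ b∈A (A-unity (∈-resp A x≈gb (∈ₗ⇒∈ A x∈as)))) (elements-∈ A)
              (Any.map⁻ x∈gas)))
          where
          gᵗ : ∀ {b} → b ∈ A → (g * b) ^ t ≈ 1# → g ^ t ≈ 1#
          gᵗ {b} b∈A gbᵗ≈1 = begin
            g ^ t          ≈⟨ trans (*-congˡ (A-unity b∈A)) (*-identityʳ (g ^ t)) ⟨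
            g ^ t * b ^ t  ≈⟨ ^-distrib-* g b t ⟨
            (g * b) ^ t    ≈⟨ gbᵗ≈1 ⟩
            1#             ∎

        d : Carrier
        d = u₁ - u₂

        d≉0 : ¬ d ≈ 0#
        d≉0 d≈0 = u₁≉u₂ (x-y≈0⇒x≈y _ _ d≈0)

        d⁻¹ = proj₁ (inverses d d≉0)
        δ = d⁻¹ ^ t

        δdᵗ≈1 : δ * d ^ t ≈ 1#
        δdᵗ≈1 = trans (sym (^-distrib-* d⁻¹ d t))
            (trans (^-congˡ t (trans (*-comm _ _) (proj₂ (inverses d d≉0)))) (1^ t))

        squares : ∀ x → (x + u₁) ^ n - (x + u₂) ^ n - d ≈ ι n * d * (h x * h x)
        squares x = begin
          (x + u₁) ^ n - (x + u₂) ^ n - d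
            ≈⟨ +-cong (solve 2 (λ x y → x :- y :=
                con (+ 1) :* x :+ (:- con (+ 1) :* y :+ con (+ 0))) refl _ _) (-‿cong (sym (moment₁ id))) ⟩
          powerSum (ps id) n x - moment (ps id) 1
            ≈⟨ double-factorisation cancel polynomial ss-distinct doubleRoots 2∣S∣≡t x ⟩
          ι n * moment (ps id) 1 * (h x * h x)
            ≈⟨ *-congʳ (*-congˡ (moment₁ id)) ⟩
          ι n * d * (h x * h x) ∎

        product : ∀ x → x ^ t - 1# ≈ translateProduct ss u₁ u₂ x
        product x = trans (factorisation cancel unity-polynomial A-distinct A-roots length-as x)
          (sym (factorisation cancel (proj₂ (translateProduct-degree ss u₁ u₂)) A-distinct translateProduct-roots
            (≡.trans length-as (≡.sym 2∣S∣≡t)) x))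

        -- Put x = d / z and multiply by x²ⁿ.
        identity : ∀ z → ¬ z ≈ 0# →
          ((1# + z) ^ n - 1# - δ * z ^ n) * (1# - (1# - z) ^ n - δ * z ^ n) ≈
          ι n * z * (1# - δ * z ^ t) * (ι n * z * (1# - δ * z ^ t))
        identity z z≉0 = x-y≈0⇒x≈y _ _ (cancel xⁿ≉0 (cancel xⁿ≉0 (begin
          xⁿ * (xⁿ * (l₁ * l₂ - ι n * z * w * (ι n * z * w)))
            ≈⟨ solve 5 (λ x l m k w → x :* (x :* (l :* m :- k :* w :* (k :* w))) :=
                (x :* l) :* (x :* m) :- (k :* (x :* w)) :* (k :* (x :* w)))
                 refl xⁿ l₁ l₂ (ι n * z) w ⟩
          (xⁿ * l₁) * (xⁿ * l₂) - (ι n * z * (xⁿ * w)) * (ι n * z * (xⁿ * w))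
            ≈⟨ +-cong (*-cong left₁ left₂) (-‿cong (*-cong right right)) ⟩
          (ι n * d * (h₂ * h₂)) * (ι n * d * (h₁ * h₁)) - (ι n * d * (h₁ * h₂)) * (ι n * d * (h₁ * h₂))
            ≈⟨ solve 3 (λ k a b → (k :* (b :* b)) :* (k :* (a :* a)) :- (k :* (a :* b)) :* (k :* (a :* b)) :=
                con (+ 0)) refl (ι n * d) h₁ h₂ ⟩
          0# ∎)))
          where
          z⁻¹ = proj₁ (inverses z z≉0)
          x = d * z⁻¹
          xⁿ = x ^ n
          h₁ = h (x - u₁)
          h₂ = h (x - u₂)
          l₁ = (1# + z) ^ n - 1# - δ * z ^ n
          l₂ = 1# - (1# - z) ^ n - δ * z ^ n
          w = 1# - δ * z ^ t

          xz≈d : x * z ≈ d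
          xz≈d = trans (solve 3 (λ d y z → d :* y :* z := d :* (z :* y)) refl d z⁻¹ z)
            (trans (*-congˡ (proj₂ (inverses z z≉0))) (*-identityʳ d))

          xⁿ≉0 : ¬ xⁿ ≈ 0#
          xⁿ≉0 = ^-nonzero n (λ x≈0 → d≉0 (trans (sym xz≈d) (trans (*-congʳ x≈0) (zeroˡ z))))

          δxᵗzᵗ : δ * (x ^ t * z ^ t) ≈ 1#
          δxᵗzᵗ = trans (*-congˡ (trans (sym (^-distrib-* x z t)) (^-congˡ t xz≈d))) δdᵗ≈1

          δxⁿzⁿ : δ * (xⁿ * z ^ n) ≈ d
          δxⁿzⁿ = begin
            δ * (x * x ^ t * (z * z ^ t))
              ≈⟨ solve 5 (λ e x y z w → e :* (x :* y :* (z :* w)) :=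
                  x :* z :* (e :* (y :* w))) refl δ x (x ^ t) z (z ^ t) ⟩
            x * z * (δ * (x ^ t * z ^ t))    ≈⟨ *-cong xz≈d δxᵗzᵗ ⟩
            d * 1#                           ≈⟨ *-identityʳ d ⟩
            d                                ∎

          scaled : ∀ {y v} → x * y ≈ v → xⁿ * y ^ n ≈ v ^ n
          scaled {y} eq = trans (sym (^-distrib-* x y n)) (^-congˡ n eq)

          -- Here x (1 + z) = x + d = (x - u₂) + u₁, which is why `squares` is taken at x - u₂.
          left₁ : xⁿ * l₁ ≈ ι n * d * (h₂ * h₂)
          left₁ = begin
            xⁿ * l₁
              ≈⟨ solve 4 (λ x p e z → x :* (p :- con (+ 1) :- e :* z) :=
                  x :* p :- x :- e :* (x :* z)) refl xⁿ _ δ (z ^ n) ⟩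
            xⁿ * (1# + z) ^ n - xⁿ - δ * (xⁿ * z ^ n) ≈⟨ +-cong (+-cong (scaled (begin
              x * (1# + z)     ≈⟨ solve 2 (λ x z → x :* (con (+ 1) :+ z) := x :+ x :* z) refl x z ⟩
              x + x * z        ≈⟨ +-congˡ xz≈d ⟩
              x + (u₁ - u₂)    ≈⟨ solve 3 (λ x u v → x :+ (u :- v) := x :- v :+ u) refl x u₁ u₂ ⟩
              x - u₂ + u₁      ∎)) (-‿cong (^-congˡ n (solve 2 (λ x v → x :=
                  x :- v :+ v) refl x u₂)))) (-‿cong δxⁿzⁿ) ⟩
            (x - u₂ + u₁) ^ n - (x - u₂ + u₂) ^ n - d ≈⟨ squares (x - u₂) ⟩
            ι n * d * (h₂ * h₂)                       ∎

          left₂ : xⁿ * l₂ ≈ ι n * d * (h₁ * h₁)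
          left₂ = begin
            xⁿ * l₂
              ≈⟨ solve 4 (λ x p e z → x :* (con (+ 1) :- p :- e :* z) :=
                  x :- x :* p :- e :* (x :* z)) refl xⁿ _ δ (z ^ n) ⟩
            xⁿ - xⁿ * (1# - z) ^ n - δ * (xⁿ * z ^ n)
              ≈⟨ +-cong (+-cong (^-congˡ n (solve 2 (λ x v → x :=
                  x :- v :+ v) refl x u₁)) (-‿cong (scaled (begin
              x * (1# - z)     ≈⟨ solve 2 (λ x z → x :* (con (+ 1) :- z) := x :- x :* z) refl x z ⟩
              x - x * z        ≈⟨ +-congˡ (-‿cong xz≈d) ⟩
              x - (u₁ - u₂)    ≈⟨ solve 3 (λ x u v → x :- (u :- v) := x :- u :+ v) refl x u₁ u₂ ⟩
              x - u₁ + u₂      ∎)))) (-‿cong δxⁿzⁿ) ⟩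
            (x - u₁ + u₁) ^ n - (x - u₁ + u₂) ^ n - d ≈⟨ squares (x - u₁) ⟩
            ι n * d * (h₁ * h₁)                       ∎

          right : ι n * z * (xⁿ * w) ≈ ι n * d * (h₁ * h₂)
          right = begin
            ι n * z * (x * x ^ t * (1# - δ * z ^ t))
              ≈⟨ solve 6 (λ n z x y e v → n :* z :* (x :* y :* (con (+ 1) :- e :* v)) :=
                  n :* (x :* z) :* (y :- e :* (y :* v))) refl (ι n) z x (x ^ t) δ (z ^ t) ⟩
            ι n * (x * z) * (x ^ t - δ * (x ^ t * z ^ t))
              ≈⟨ *-cong (*-congˡ xz≈d) (trans (+-congˡ (-‿cong δxᵗzᵗ)) (product x)) ⟩
            ι n * d * (h₁ * h₂)                                   ∎

    less-than-half : ∀ {ss us} → Decomposition ss us → 2 ℕ.≤ length us → length ss ℕ.+ length ss ℕ.< t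
    less-than-half {us = _ ∷ []} _ (ℕ.s≤s ())
    less-than-half {us = u₁ ∷ u₂ ∷ us} D _ with ι n ≈? 0# | Decomposition.us-distinct D
    ... | yes n≈0 | (u₁≉u₂ ∷ _) ∷ _ = Pair.less-than-half u₁≉u₂ (Decomposition.ss-distinct D)
          (All.zip (Decomposition.unity D (here refl) , Decomposition.unity D (there (here refl)))) n≈0
    ... | no  n≉0 | (u₁≉u₂ ∷ _) ∷ _ = ℕ.≤∧≢⇒< (Pair.at-most-half u₁≉u₂ (Decomposition.ss-distinct D)
          (All.zip (Decomposition.unity D (here refl) , Decomposition.unity D (there (here refl)))) n≉0)
              (not-half D)
      where
      not-half : ∀ {us} → Decomposition _ (u₁ ∷ u₂ ∷ us) → _ ≢ t
      not-half {[]}    D = half-contradicts-two D n≉0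
      not-half {_ ∷ _} D = half-contradicts-three D n≉0

    -- This rests on strictness: with two elements in `us`, the covering bound t ≤ 2 |S| contradicts
    -- 2 |S| < t but not 2 |S| ≤ t.
    at-least-three : ∀ {ss us} → Decomposition ss us → 2 ℕ.≤ length ss → 2 ℕ.≤ length us → 3 ℕ.≤ length us
    at-least-three {us = _ ∷ []} _ _ (ℕ.s≤s ())
    at-least-three {us = _ ∷ _ ∷ []} D 2≤∣S∣ 2≤∣T∣ =
      ⊥-elim (ℕ.<⇒≱ (less-than-half D 2≤∣T∣) (covered-by-two D))
    at-least-three {us = _ ∷ _ ∷ _ ∷ _} _ _ _ = ℕ.s≤s (ℕ.s≤s (ℕ.s≤s ℕ.z≤n))

-- Passage from subsets of the field to lists of their elements.

open import Data.Nat.Base using (_≤_; _<_; _*_; _∸_; _^_)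

theorem1p4 :
    ∀ {c ℓ} (p f q k : ℕ) → Prime p → 1 ≤ f → q ≡ p ^ f → k ∣ q ∸ 1 →
    (F : FiniteField c ℓ q) →
    let open FieldSubsets F
        A = powers k
        t = ∣ A ∣
    in
    A ⊂ units →
    (∀ x → 𝔽ₚ⟨ A ⟩ x) →
    5 ≤ t →
    (S T : Subset q) → 2 ≤ ∣ S ∣ → 2 ≤ ∣ T ∣ →
    A ≡ S ⊕ T →
    (3 ≤ ∣ S ∣ × 2 * ∣ S ∣ ≤ t) ×
    (3 ≤ ∣ T ∣ × 2 * ∣ T ∣ ≤ t) ×
    (3 ≤ k → 2 * ∣ S ∣ < t × 2 * ∣ T ∣ < t)
theorem1p4 p f q k p-prime _ q≡pᶠ _ F (_ , i , i∈units , i∉A) generates 5≤t S T 2≤∣S∣ 2≤∣T∣ A≡S⊕T =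
  (three {T} {S} (swap D) 2≤∣T∣ 2≤∣S∣ , ℕ.<⇒≤ S-half) ,
  (three {S} {T} D 2≤∣S∣ 2≤∣T∣ , ℕ.<⇒≤ T-half) ,
  λ _ → S-half , T-half
  where
  open FiniteField F using (trans; sym; reflexive; _≈_; 0#; element; index-element)
  open FieldSubsets F
  open FiniteFieldProperties F
  open IntegerCoefficients (FiniteField.commutativeRing F) using (ι)

  t≡ : ∣ powers k ∣ ≡ 5 ℕ.+ (∣ powers k ∣ ∸ 5)
  t≡ = ≡.sym (ℕ.m+[n∸m]≡n 5≤t)

  -- The f-th power of p in the field is q, hence zero, and a field has no nilpotents.
  ιp≈0 : ι p ≈ 0#
  ιp≈0 = ^-zero⁻¹ f (trans (sym (ι-^ p f)) (trans (reflexive (≡.cong ι (≡.sym q≡pᶠ))) ι-q))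

  -- The unit that witnesses properness of A serves as `g`.
  open PowerSubgroup.SumsetDecompositions F p-prime ιp≈0 k (∣ powers k ∣ ∸ 5) t≡ generates
    (Equivalence.to (∈-units (element i)) (≡.subst (Subset._∈ units) (≡.sym (index-element i)) i∈units))
    (λ g∈A → i∉A (≡.subst (Subset._∈ powers k) (index-element i) g∈A))

  D : Decomposition (elements S) (elements T)
  D = record
    { ss-distinct = elements-distinct S
    ; us-distinct = elements-distinct T
    ; sums = λ s∈S u∈T → ≡.subst (_ ∈_) (≡.sym A≡S⊕T)
        (Equivalence.from (∈-⊕ S T _) (_ , _ , ∈ₗ⇒∈ S s∈S , ∈ₗ⇒∈ T u∈T , FiniteField.refl F))
    ; covers = λ a∈A →
        let s , u , s∈S , u∈T , a≈s+u = Equivalence.to (∈-⊕ S T _) (≡.subst (_ ∈_) A≡S⊕T a∈A) in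
        s , u , elements-complete s∈S , elements-complete u∈T , a≈s+u
    }

  size : ∀ U → 2 ≤ ∣ U ∣ → 2 ≤ length (elements U)
  size U = ≡.subst (2 ≤_) (≡.sym (length-elements U))

  half : ∀ {U V} → Decomposition (elements U) (elements V) → 2 ≤ ∣ V ∣ → 2 * ∣ U ∣ < ∣ powers k ∣
  half {U} {V} D 2≤∣V∣ = ≡.subst₂ _<_
    (≡.cong₂ ℕ._+_ (length-elements U) (≡.trans (length-elements U) (≡.sym (ℕ.+-identityʳ ∣ U ∣))))
    (≡.sym t≡) (less-than-half D (size V 2≤∣V∣))

  three : ∀ {U V} → Decomposition (elements U) (elements V) → 2 ≤ ∣ U ∣ → 2 ≤ ∣ V ∣ → 3 ≤ ∣ V ∣
  three {U} {V} D 2≤∣U∣ 2≤∣V∣ =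
    ≡.subst (3 ≤_) (length-elements V) (at-least-three D (size U 2≤∣U∣) (size V 2≤∣V∣))

  S-half : 2 * ∣ S ∣ < ∣ powers k ∣
  S-half = half {S} {T} D 2≤∣T∣

  T-half : 2 * ∣ T ∣ < ∣ powers k ∣
  T-half = half {T} {S} (swap D) 2≤∣S∣
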